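{- Let $a$ be an indeterminate or a nonzero complex number, and let $|q|<1$. Define \[ S_a(q):=\sum_{m\ge0}\frac{(aq;q^2)_m(q/a;q^2)_m\, q^{2m}}{(-q^2;q^2)_m}, \qquad P_a(q):=(q^4;q^4)_\infty S_a(q). \] Then \[ P_a(q)\big|_{n\equiv 0\ (\mathrm{mod}\ 2)} = \sum_{n\ge0}(-1)^nq^{6n^2+4n}(1+q^{4n+2}) \sum_{j=-n}^{n}(-1)^j a^{2j}q^{ -2j^2}, \] and \[ P_a(q)\big|_{n\equiv 1\ (\mathrm{mod}\ 2)} = \sum_{n\ge0}(-1)^{n+1}q^{6n^2+10n+3}(1+q^{4n+4}) \sum_{j=0}^{n}(-1)^j \big(a^{2j+1}+a^{ -2j-1}\big)q^{ -2j(j+1)}. \]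
   Context: Standard $q$-Pochhammer notation: $(x;q)_0=1$, $(x;q)_n=\prod_{j=0}^{n-1}(1-xq^j)$, $(x;q)_\infty=\prod_{j\ge0}(1-xq^j)$. For a series $F(q)=\sum_{n} A(n)q^n$ (coefficients possibly depending on $a$), $F(q)\big|_{n\equiv r\ (\mathrm{mod}\ N)}:=\sum_{n\equiv r \ (\mathrm{mod}\ N)}A(n)q^n$ denotes the part of $F$ supported on exponents congruent to $r$ modulo $N$. -}

module Defs where

open import Algebra.Bundles using (CommutativeRing)
open import Data.Nat using (ℕ; zero; suc; _+_; _*_; _∸_; _≟_; _%_)
open import Data.Integer as ℤ using (ℤ; +_; -[1+_]; ∣_∣)
open import Data.Bool using (if_then_else_)
open import Relation.Nullary.Decidable using (⌊_⌋)

-- Formal power series in q with coefficients in a commutative ring R,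
-- where a is an element of R with inverse a⁻ (a * a⁻ ≈ 1 is assumed in the theorem).
-- Taking R = ℤ[a,a⁻¹] recovers the "indeterminate a" reading; R = ℂ the numeric one.
module QSeries {c ℓ} (R : CommutativeRing c ℓ) (a a⁻ : CommutativeRing.Carrier R) where
  open CommutativeRing R using (Carrier; 0#; 1#; -_) renaming (_+_ to _+ᴿ_; _*_ to _*ᴿ_)

  PS : Set c
  PS = ℕ → Carrier

  pow : Carrier → ℕ → Carrier
  pow x zero    = 1#
  pow x (suc k) = x *ᴿ pow x k

  neg1^ : ℕ → Carrier
  neg1^ k = pow (- 1#) k

  apow : ℤ → Carrier
  apow (+ k)      = pow a k
  apow -[1+ k ]   = pow a⁻ (suc k)

  sumTo : ℕ → (ℕ → Carrier) → Carrier
  sumTo zero    f = f 0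
  sumTo (suc n) f = sumTo n f +ᴿ f (suc n)

  1ₛ : PS
  1ₛ zero    = 1#
  1ₛ (suc n) = 0#

  _⊕_ : PS → PS → PS
  (f ⊕ g) n = f n +ᴿ g n

  _⊗_ : PS → PS → PS
  (f ⊗ g) n = sumTo n (λ i → f i *ᴿ g (n ∸ i))

  infixl 6 _⊕_
  infixl 7 _⊗_

  mono : Carrier → ℕ → PS
  mono x k n = if ⌊ n ≟ k ⌋ then x else 0#

  sumPS : ℕ → (ℕ → PS) → PS
  sumPS N t n = sumTo N (λ i → t i n)

  -- infinite sum Σ_{m≥0} t m, for families where t m has q-order ≥ m
  -- (so only m ≤ n contribute to the coefficient of q^n)
  Σ∞ : (ℕ → PS) → PS
  Σ∞ t n = sumTo n (λ m → t m n)

  prodLt : ℕ → (ℕ → PS) → PS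
  prodLt zero    t = 1ₛ
  prodLt (suc m) t = prodLt m t ⊗ t m

  -- 1/(1+q^k) = Σ_i (-1)^i q^{k i}   (used only with k ≥ 1)
  invOnePlus : ℕ → PS
  invOnePlus k = Σ∞ (λ i → mono (neg1^ i) (k * i))

  aqPoch : ℕ → PS
  aqPoch m = prodLt m (λ j → 1ₛ ⊕ mono (- a) (2 * j + 1))

  qaPoch : ℕ → PS
  qaPoch m = prodLt m (λ j → 1ₛ ⊕ mono (- a⁻) (2 * j + 1))

  invMinusq2Poch : ℕ → PS
  invMinusq2Poch m = prodLt m (λ j → invOnePlus (2 * (j + 1)))

  S : PS
  S = Σ∞ (λ m → aqPoch m ⊗ qaPoch m ⊗ mono 1# (2 * m) ⊗ invMinusq2Poch m)

  -- (q^4;q^4)_∞ : the coefficient of q^n only depends on the factors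
  -- (1 - q^{4(j+1)}) with j ≤ n
  q4Inf : PS
  q4Inf n = prodLt (suc n) (λ j → 1ₛ ⊕ mono (- 1#) (4 * (j + 1))) n

  P : PS
  P = q4Inf ⊗ S

  restrict2 : ℕ → PS → PS
  restrict2 r f n = if ⌊ n % 2 ≟ r ⌋ then f n else 0#

  -- Σ_{n≥0} (-1)^n q^{6n²+4n} (1+q^{4n+2}) Σ_{j=-n}^{n} (-1)^j a^{2j} q^{-2j²}
  -- (inner index i = j + n ∈ [0,2n]; all q-exponents are nonnegative, ∸ is exact)
  RHS0 : PS
  RHS0 = Σ∞ (λ n → sumPS (2 * n) (λ i →
           let j = (+ i) ℤ.- (+ n)
               k = ∣ j ∣
               x = neg1^ n *ᴿ (neg1^ k *ᴿ apow ((+ 2) ℤ.* j))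
           in mono x (6 * n * n + 4 * n ∸ 2 * k * k)
              ⊕ mono x (6 * n * n + 4 * n + (4 * n + 2) ∸ 2 * k * k)))

  RHS1 : PS
  RHS1 = Σ∞ (λ n → sumPS n (λ j →
           let x = neg1^ (n + 1) *ᴿ (neg1^ j *ᴿ (pow a (2 * j + 1) +ᴿ pow a⁻ (2 * j + 1)))
           in mono x (6 * n * n + 10 * n + 3 ∸ 2 * j * (j + 1))
              ⊕ mono x (6 * n * n + 10 * n + 3 + (4 * n + 4) ∸ 2 * j * (j + 1))))

{-# OPTIONS --safe #-}
module Submission where

-- Write Q = q² and [n,k] for the Q-binomial coefficients. By the finite Jacobi triple
-- product, (aq;q²)_m (q/a;q²)_m = Σ_J [2m,m+J] w_J with w_0 = 1 and
-- w_J = (-1)^J q^(J²) (a^J + a^(-J)), so the w_J separate the parity of the exponents.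
-- Let W be determined by W_N + Q^(3N-3) W_(N-2) = w_N. A contiguous relation of the
-- Q-binomials makes the partial sums of S telescope:
--   (-Q;Q)_M Σ_(m<M) (aq;q²)_m (q/a;q²)_m Q^m / (-Q;Q)_m
--     = Σ_N [2M,M+N+1] Q^N (1 + Q^(N+1)) W_N.
-- After multiplication by (Q;Q)_M the binomial disappears modulo Q^M, hence
-- P = Σ_N Q^N (1 + Q^(N+1)) W_N. Solving the recursion for W shows that the terms with N
-- even and N odd are those of the two right-hand sides. Coefficients up to q^n are
-- computed in the ring R[[q]]/(q^(n+1)), where all sums and products are finite.

open import Defs
open import Algebra.Bundles using (CommutativeRing)
open import Algebra.Solver.Ring.AlmostCommutativeRing
  using (fromCommutativeRing; _-Raw-AlmostCommutative⟶_)
open import Data.Integer as ℤ using (ℤ; +_; -[1+_]; ∣_∣)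
import Data.Integer.Properties as ℤₚ
open import Data.Maybe.Base using (Maybe; just; nothing)
open import Data.Nat as ℕ using (ℕ; zero; suc; _∸_; _%_; _≤_; _<_; _≟_; z≤n; s≤s)
open import Data.Nat.DivMod using (m%n<n; [m+kn]%n≡m%n; m*n%n≡0)
import Data.Nat.Properties as ℕₚ
open import Data.Nat.Solver using (module +-*-Solver)
open import Data.Product using (_,_)
open import Data.Sum.Base using (inj₁; inj₂)
open import Function.Base using (_∘_)
open import Relation.Binary.PropositionalEquality as ≡ using (_≡_; _≢_)
open import Relation.Nullary.Decidable using (yes; no)
open import Relation.Nullary.Negation using (contradiction)

-- The weights W are forced. The contiguous relation takes [2M,M+N+1] Q^N (1 + Q^(N+1)) from M to
-- M+1 by multiplying it with 1 + Q^(M+1), the next factor of (-Q;Q), and adding Q^M (1 + Q^(M+1))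
-- times [2M,M+N] + Q^(3N+3) [2M,M+N+2]. Summed against W_N, the coefficient of [2M,M+N] in the
-- added part is W_N + Q^(3N-3) W_(N-2), and the summand of S asks for w_N in that place. The
-- prefactor does two jobs, because (q^4;q^4)_M = (-Q;Q)_M (Q;Q)_M: one half clears the denominators
-- of S, the other removes the binomials. The coefficient ring is arbitrary, so 1 - Q^k is never
-- divided by: relations between Q-binomials stay in multiplied-out form, and the limit M → ∞
-- becomes the hypothesis that a power of Q is zero, which holds in the truncated ring.

-- A ring solver with integer coefficients for an arbitrary commutative ring.

module IntegerCoefficients {c ℓ} (R : CommutativeRing c ℓ) where
  open CommutativeRing R hiding (zero)
  open import Algebra.Properties.Ring ring
    using (-0#≈0#; -‿distribˡ-*; -‿distribʳ-*; -‿involutive)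
  open import Algebra.Properties.AbelianGroup +-abelianGroup using (⁻¹-∙-comm)
  open import Algebra.Properties.Semiring.Mult.TCOptimised semiring
  open import Relation.Binary.Reasoning.Setoid setoid

  ⟦_⟧ : ℤ → Carrier
  ⟦ + n ⟧      = n × 1#
  ⟦ -[1+ n ] ⟧ = - (suc n × 1#)

  neg-homo : ∀ i → ⟦ ℤ.- i ⟧ ≈ - ⟦ i ⟧
  neg-homo (+ zero)   = sym -0#≈0#
  neg-homo (+ suc n)  = refl
  neg-homo -[1+ n ]   = sym (-‿involutive _)

  ⊖-homo : ∀ m n → ⟦ m ℤ.⊖ n ⟧ ≈ m × 1# - n × 1#
  ⊖-homo zero    zero    = sym (-‿inverseʳ _)
  ⊖-homo zero    (suc n) = sym (+-identityˡ _)
  ⊖-homo (suc m) zero    = sym (trans (+-congˡ -0#≈0#) (+-identityʳ _))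
  ⊖-homo (suc m) (suc n) = begin
    ⟦ suc m ℤ.⊖ suc n ⟧                      ≡⟨ ≡.cong ⟦_⟧ (ℤₚ.[1+m]⊖[1+n]≡m⊖n m n) ⟩
    ⟦ m ℤ.⊖ n ⟧                              ≈⟨ ⊖-homo m n ⟩
    m × 1# - n × 1#                          ≈⟨ +-congʳ (+-identityʳ _) ⟨
    m × 1# + 0# - n × 1#                     ≈⟨ +-congʳ (+-congˡ (-‿inverseʳ 1#)) ⟨
    m × 1# + (1# - 1#) - n × 1#              ≈⟨ +-congʳ (+-assoc _ _ _) ⟨
    m × 1# + 1# - 1# - n × 1#                ≈⟨ +-assoc _ _ _ ⟩
    m × 1# + 1# + (- 1# - n × 1#)            ≈⟨ +-cong (+-comm _ _) (⁻¹-∙-comm _ _) ⟩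
    1# + m × 1# - (1# + n × 1#)              ≈⟨ +-cong (1+× m 1#) (-‿cong (1+× n 1#)) ⟨
    suc m × 1# - suc n × 1#                  ∎

  +-homo : ∀ i j → ⟦ i ℤ.+ j ⟧ ≈ ⟦ i ⟧ + ⟦ j ⟧
  +-homo (+ m)    (+ n)    = ×-homo-+ 1# m n
  +-homo (+ m)    -[1+ n ] = ⊖-homo m (suc n)
  +-homo -[1+ m ] (+ n)    = trans (⊖-homo n (suc m)) (+-comm _ _)
  +-homo -[1+ m ] -[1+ n ] = begin
    - (suc (suc (m ℕ.+ n)) × 1#)        ≡⟨ ≡.cong (λ k → - (suc k × 1#)) (≡.sym (ℕₚ.+-suc m n)) ⟩
    - ((suc m ℕ.+ suc n) × 1#)          ≈⟨ -‿cong (×-homo-+ 1# (suc m) (suc n)) ⟩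
    - (suc m × 1# + suc n × 1#)         ≈⟨ ⁻¹-∙-comm _ _ ⟨
    - (suc m × 1#) - suc n × 1#         ∎

  *-homo⁺ : ∀ m j → ⟦ + m ℤ.* j ⟧ ≈ m × 1# * ⟦ j ⟧
  *-homo⁺ m (+ n) = begin
    ⟦ + m ℤ.* + n ⟧    ≡⟨ ≡.cong ⟦_⟧ (ℤₚ.pos-* m n) ⟨
    (m ℕ.* n) × 1#     ≈⟨ ×1-homo-* m n ⟩
    m × 1# * n × 1#    ∎
  *-homo⁺ m -[1+ n ] = begin
    ⟦ + m ℤ.* -[1+ n ] ⟧        ≡⟨ ≡.cong ⟦_⟧ (ℤₚ.neg-distribʳ-* (+ m) (+ suc n)) ⟨
    ⟦ ℤ.- (+ m ℤ.* + suc n) ⟧   ≈⟨ neg-homo (+ m ℤ.* + suc n) ⟩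
    - ⟦ + m ℤ.* + suc n ⟧       ≈⟨ -‿cong (*-homo⁺ m (+ suc n)) ⟩
    - (m × 1# * suc n × 1#)     ≈⟨ -‿distribʳ-* _ _ ⟩
    m × 1# * - (suc n × 1#)     ∎

  *-homo : ∀ i j → ⟦ i ℤ.* j ⟧ ≈ ⟦ i ⟧ * ⟦ j ⟧
  *-homo (+ m)    j = *-homo⁺ m j
  *-homo -[1+ m ] j = begin
    ⟦ -[1+ m ] ℤ.* j ⟧          ≡⟨ ≡.cong ⟦_⟧ (ℤₚ.neg-distribˡ-* (+ suc m) j) ⟨
    ⟦ ℤ.- (+ suc m ℤ.* j) ⟧     ≈⟨ neg-homo (+ suc m ℤ.* j) ⟩
    - ⟦ + suc m ℤ.* j ⟧         ≈⟨ -‿cong (*-homo⁺ (suc m) j) ⟩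
    - (suc m × 1# * ⟦ j ⟧)      ≈⟨ -‿distribˡ-* _ _ ⟩
    - (suc m × 1#) * ⟦ j ⟧      ∎

  homomorphism : CommutativeRing.rawRing ℤₚ.+-*-commutativeRing
                 -Raw-AlmostCommutative⟶ fromCommutativeRing R
  homomorphism = record
    { ⟦_⟧    = ⟦_⟧
    ; +-homo = +-homo
    ; *-homo = *-homo
    ; -‿homo = neg-homo
    ; 0-homo = refl
    ; 1-homo = refl
    }

  -- Equality in `R` need not be decidable. Comparing the integers themselves is enough for the
  -- solver to cancel terms with opposite signs.
  dec : ∀ i j → Maybe (⟦ i ⟧ ≈ ⟦ j ⟧)
  dec i j with i ℤ.≟ j
  ... | yes i≡j = just (reflexive (≡.cong ⟦_⟧ i≡j))
  ... | no  _   = nothing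

  open import Algebra.Solver.Ring _ _ homomorphism dec public
    using (Polynomial; con; solve; _:=_; _:+_; _:*_; _:-_; :-_; _:^_)

  :1 : ∀ {n} → Polynomial n
  :1 = con (+ 1)

  :0 : ∀ {n} → Polynomial n
  :0 = con (+ 0)

-- Doubling, finite sums and powers.

dbl : ℕ → ℕ
dbl zero    = zero
dbl (suc n) = suc (suc (dbl n))

dbl≡ : ∀ n → dbl n ≡ n ℕ.+ n
dbl≡ zero    = ≡.refl
dbl≡ (suc n) = ≡.cong suc (≡.trans (≡.cong suc (dbl≡ n)) (≡.sym (ℕₚ.+-suc n n)))

dbl-∸ : ∀ M N → dbl M ∸ (M ℕ.+ N) ≡ M ∸ N
dbl-∸ M N = ≡.trans (≡.cong (_∸ (M ℕ.+ N)) (dbl≡ M)) (ℕₚ.[m+n]∸[m+o]≡n∸o M M N)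

module Sums {c ℓ} (R : CommutativeRing c ℓ) (a a⁻ : CommutativeRing.Carrier R) where
  open CommutativeRing R hiding (zero)
  open QSeries R a a⁻ using (sumTo; pow)
  open IntegerCoefficients R
  open import Relation.Binary.Reasoning.Setoid setoid

  sumTo-cong-≤ : ∀ n {f g} → (∀ i → i ≤ n → f i ≈ g i) → sumTo n f ≈ sumTo n g
  sumTo-cong-≤ zero    f≈g = f≈g 0 z≤n
  sumTo-cong-≤ (suc n) f≈g =
    +-cong (sumTo-cong-≤ n (λ i i≤n → f≈g i (ℕₚ.m≤n⇒m≤1+n i≤n))) (f≈g (suc n) ℕₚ.≤-refl)

  sumTo-cong : ∀ n {f g} → (∀ i → f i ≈ g i) → sumTo n f ≈ sumTo n g
  sumTo-cong n f≈g = sumTo-cong-≤ n (λ i _ → f≈g i)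

  sumTo-zero : ∀ n {f} → (∀ i → i ≤ n → f i ≈ 0#) → sumTo n f ≈ 0#
  sumTo-zero zero    f≈0 = f≈0 0 z≤n
  sumTo-zero (suc n) f≈0 = trans
    (+-cong (sumTo-zero n (λ i i≤n → f≈0 i (ℕₚ.m≤n⇒m≤1+n i≤n))) (f≈0 (suc n) ℕₚ.≤-refl))
    (+-identityˡ 0#)

  sumTo-+ : ∀ n f g → sumTo n (λ i → f i + g i) ≈ sumTo n f + sumTo n g
  sumTo-+ zero    f g = refl
  sumTo-+ (suc n) f g = trans (+-congʳ (sumTo-+ n f g))
    (solve 4 (λ s t x y → s :+ t :+ (x :+ y) := s :+ x :+ (t :+ y)) refl _ _ _ _)

  sumTo-*ˡ : ∀ n x f → x * sumTo n f ≈ sumTo n (λ i → x * f i)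
  sumTo-*ˡ zero    x f = refl
  sumTo-*ˡ (suc n) x f = trans (distribˡ x _ _) (+-congʳ (sumTo-*ˡ n x f))

  sumTo-*ʳ : ∀ n x f → sumTo n f * x ≈ sumTo n (λ i → f i * x)
  sumTo-*ʳ zero    x f = refl
  sumTo-*ʳ (suc n) x f = trans (distribʳ x _ _) (+-congʳ (sumTo-*ʳ n x f))

  sumTo-shift : ∀ n f → sumTo (suc n) f ≈ f 0 + sumTo n (λ i → f (suc i))
  sumTo-shift zero    f = refl
  sumTo-shift (suc n) f = trans (+-congʳ (sumTo-shift n f)) (+-assoc _ _ _)

  sumTo-extend : ∀ n d {f} → (∀ i → n < i → f i ≈ 0#) → sumTo (n ℕ.+ d) f ≈ sumTo n f
  sumTo-extend n zero    {f} f≈0 = reflexive (≡.cong (λ k → sumTo k f) (ℕₚ.+-identityʳ n))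
  sumTo-extend n (suc d) {f} f≈0 rewrite ℕₚ.+-suc n d = trans
    (+-cong (sumTo-extend n d f≈0) (f≈0 _ (s≤s (ℕₚ.m≤m+n n d)))) (+-identityʳ _)

  sumTo-pairs : ∀ n f → sumTo (suc (dbl n)) f ≈ sumTo n (λ k → f (dbl k) + f (suc (dbl k)))
  sumTo-pairs zero    f = refl
  sumTo-pairs (suc n) f = trans (+-assoc _ _ _) (+-congʳ (sumTo-pairs n f))

  pow-+ : ∀ x m n → pow x (m ℕ.+ n) ≈ pow x m * pow x n
  pow-+ x zero    n = sym (*-identityˡ _)
  pow-+ x (suc m) n = trans (*-congˡ (pow-+ x m n)) (sym (*-assoc _ _ _))

  pow-* : ∀ x y n → pow (x * y) n ≈ pow x n * pow y n
  pow-* x y zero    = sym (*-identityˡ _)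
  pow-* x y (suc n) = trans (*-congˡ (pow-* x y n))
    (solve 4 (λ x y s t → x :* y :* (s :* t) := x :* s :* (y :* t)) refl _ _ _ _)

  pow-*ℕ : ∀ x m n → pow x (m ℕ.* n) ≈ pow (pow x n) m
  pow-*ℕ x zero    n = refl
  pow-*ℕ x (suc m) n = trans (pow-+ x n (m ℕ.* n)) (*-congˡ (pow-*ℕ x m n))

  pow-vanish : ∀ {x m n} → m ≤ n → pow x m ≈ 0# → pow x n ≈ 0#
  pow-vanish {x} {m} {n} m≤n x^m≈0 = begin
    pow x n                       ≡⟨ ≡.cong (pow x) (ℕₚ.m+[n∸m]≡n m≤n) ⟨
    pow x (m ℕ.+ (n ∸ m))         ≈⟨ pow-+ x m (n ∸ m) ⟩
    pow x m * pow x (n ∸ m)       ≈⟨ *-congʳ x^m≈0 ⟩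
    0# * pow x (n ∸ m)            ≈⟨ zeroˡ _ ⟩
    0#                            ∎

  -- Adding a multiple of a vanishing difference: how a hypothesis l ≈ r enters a
  -- solver identity.
  modulo : ∀ t k {l r} → l ≈ r → t + k * (l - r) ≈ t
  modulo t k {l} {r} l≈r = begin
    t + k * (l - r)    ≈⟨ +-congˡ (*-congˡ (+-congʳ l≈r)) ⟩
    t + k * (r - r)    ≈⟨ solve 3 (λ t k r → t :+ k :* (r :- r) := t) refl t k r ⟩
    t                  ∎

-- Q-binomial coefficients and the central ones [2M,M+N].

module QBinomial {c ℓ} (R : CommutativeRing c ℓ) (a a⁻ Q : CommutativeRing.Carrier R) where
  open CommutativeRing R hiding (zero)
  open QSeries R a a⁻ using (pow)
  open Sums R a a⁻
  open IntegerCoefficients R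
  open import Relation.Binary.Reasoning.Setoid setoid

  binom : ℕ → ℕ → Carrier
  binom n       zero    = 1#
  binom zero    (suc k) = 0#
  binom (suc n) (suc k) = binom n k + pow Q (suc k) * binom n (suc k)

  binom-zero : ∀ {n k} → n < k → binom n k ≈ 0#
  binom-zero {zero}  {suc k} _         = refl
  binom-zero {suc n} {suc k} (s≤s n<k) = begin
    binom n k + pow Q (suc k) * binom n (suc k)
      ≈⟨ +-cong (binom-zero n<k) (*-congˡ (binom-zero (ℕₚ.m<n⇒m<1+n n<k))) ⟩
    0# + pow Q (suc k) * 0#
      ≈⟨ solve 1 (λ x → :0 :+ x :* :0 := :0) refl _ ⟩
    0# ∎

  binom-diag : ∀ n → binom n n ≈ 1#
  binom-diag zero    = refl
  binom-diag (suc n) = trans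
    (+-cong (binom-diag n) (trans (*-congˡ (binom-zero (ℕₚ.n<1+n n))) (zeroʳ _))) (+-identityʳ 1#)

  -- Adding the exponents is wrong only if `n ∸ k` is truncated, and then k′ > n, so that the
  -- binomial vanishes.
  binom-shift : ∀ n {k k′} → k ≤ k′ →
    pow Q k * (pow Q (n ∸ k) * binom n k′) ≈ pow Q n * binom n k′
  binom-shift n {k} {k′} k≤k′ with ℕₚ.<-≤-connex n k′
  ... | inj₁ n<k′ = begin
    pow Q k * (pow Q (n ∸ k) * binom n k′) ≈⟨ *-congˡ (trans (*-congˡ (binom-zero n<k′)) (zeroʳ _)) ⟩
    pow Q k * 0#                           ≈⟨ zeroʳ _ ⟩
    0#                                     ≈⟨ trans (*-congˡ (binom-zero n<k′)) (zeroʳ _) ⟨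
    pow Q n * binom n k′                   ∎
  ... | inj₂ k′≤n = begin
    pow Q k * (pow Q (n ∸ k) * binom n k′) ≈⟨ *-assoc _ _ _ ⟨
    pow Q k * pow Q (n ∸ k) * binom n k′   ≈⟨ *-congʳ (pow-+ Q k (n ∸ k)) ⟨
    pow Q (k ℕ.+ (n ∸ k)) * binom n k′     ≡⟨ ≡.cong (λ e → pow Q e * binom n k′)
                                                (ℕₚ.m+[n∸m]≡n (ℕₚ.≤-trans k≤k′ k′≤n)) ⟩
    pow Q n * binom n k′                   ∎

  -- The mirror image of the defining recursion, with the power of Q on the other summand.
  pascal₂ : ∀ n k → binom (suc n) (suc k) ≈ pow Q (n ∸ k) * binom n k + binom n (suc k)
  pascal₂ zero    zero    = solve 1 (λ Q → :1 :+ Q :* :1 :* :0 := :1 :* :1 :+ :0) refl Q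
  pascal₂ zero    (suc k) =
    solve 1 (λ x → :0 :+ x :* :0 := :1 :* :0 :+ :0) refl (pow Q (suc (suc k)))
  pascal₂ (suc n) zero    = begin
    1# + Q * 1# * binom (suc n) 1
      ≈⟨ +-congˡ (*-congˡ (pascal₂ n zero)) ⟩
    1# + Q * 1# * (pow Q n * 1# + binom n 1)
      ≈⟨ solve 3 (λ Q x y → :1 :+ Q :* :1 :* (x :* :1 :+ y) := Q :* x :* :1 :+ (:1 :+ Q :* :1 :* y))
               refl Q (pow Q n) (binom n 1) ⟩
    pow Q (suc n) * 1# + binom (suc n) 1 ∎
  pascal₂ (suc n) (suc k) = begin
    binom (suc n) (suc k) + pow Q (2 ℕ.+ k) * binom (suc n) (2 ℕ.+ k)
      ≈⟨ +-cong (pascal₂ n k) (*-congˡ (pascal₂ n (suc k))) ⟩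
    e * X + Y + pow Q (2 ℕ.+ k) * (f * Y + Z)
      ≈⟨ solve 7 (λ Q s e f X Y Z → e :* X :+ Y :+ Q :* s :* (f :* Y :+ Z)
                   := Q :* (s :* (f :* Y)) :+ (e :* X :+ Y :+ Q :* s :* Z))
               refl Q (pow Q (suc k)) e f X Y Z ⟩
    Q * (pow Q (suc k) * (f * Y)) + (e * X + Y + pow Q (2 ℕ.+ k) * Z)
      -- The two expansions differ only in how the exponent n of the power of Q at `Y` is split, as
      -- (k+1) + (n-k-1) or as k + (n-k).
      ≈⟨ +-congʳ (*-congˡ (trans (binom-shift n {suc k} ℕₚ.≤-refl) (sym (binom-shift n (ℕₚ.n≤1+n k))))) ⟩
    Q * (pow Q k * (e * Y)) + (e * X + Y + pow Q (2 ℕ.+ k) * Z)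
      ≈⟨ solve 7 (λ Q s e t X Y Z → Q :* (s :* (e :* Y)) :+ (e :* X :+ Y :+ t :* Z)
                   := e :* (X :+ Q :* s :* Y) :+ (Y :+ t :* Z))
               refl Q (pow Q k) e (pow Q (2 ℕ.+ k)) X Y Z ⟩
    e * binom (suc n) (suc k) + binom (suc n) (2 ℕ.+ k) ∎
    where
    e = pow Q (n ∸ k)
    f = pow Q (n ∸ suc k)
    X = binom n k
    Y = binom n (suc k)
    Z = binom n (2 ℕ.+ k)

  -- Both Pascal rules evaluate `binom (suc n) (suc k)`; their difference is this relation, with no
  -- quotient formula for the binomial.
  absorb : ∀ n k →
    (1# - pow Q (n ∸ k)) * binom n k ≈ (1# - pow Q (suc k)) * binom n (suc k)
  absorb n k = begin
    (1# - e) * X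
      ≈⟨ modulo _ (- 1#) (pascal₂ n k) ⟨
    (1# - e) * X + - 1# * (X + s * Y - (e * X + Y))
      ≈⟨ solve 4 (λ e s X Y → (:1 :- e) :* X :+ :- :1 :* (X :+ s :* Y :- (e :* X :+ Y))
                   := (:1 :- s) :* Y) refl e s X Y ⟩
    (1# - s) * Y ∎
    where
    e = pow Q (n ∸ k)
    s = pow Q (suc k)
    X = binom n k
    Y = binom n (suc k)

  -- Reflection exchanges the two Pascal rules, so one side is expanded by the definition and the
  -- other by `pascal₂`.
  binom-sym : ∀ i j → binom (i ℕ.+ j) i ≈ binom (i ℕ.+ j) j
  binom-sym zero    j       = sym (binom-diag j)
  binom-sym (suc i) zero    rewrite ℕₚ.+-identityʳ i = binom-diag (suc i)
  binom-sym (suc i) (suc j) = begin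
    binom n i + pow Q (suc i) * binom n (suc i)
      ≈⟨ +-comm _ _ ⟩
    pow Q (suc i) * binom n (suc i) + binom n i
      ≈⟨ +-cong (*-cong (reflexive (≡.cong (pow Q) (≡.sym n∸j))) other) (binom-sym i (suc j)) ⟩
    pow Q (n ∸ j) * binom n j + binom n (suc j)
      ≈⟨ pascal₂ n j ⟨
    binom (suc n) (suc j) ∎
    where
    n = i ℕ.+ suc j
    n∸j : n ∸ j ≡ suc i
    n∸j = ≡.trans (≡.cong (_∸ j) (ℕₚ.+-suc i j)) (ℕₚ.m+n∸n≡m (suc i) j)
    other : binom n (suc i) ≈ binom n j
    other rewrite ℕₚ.+-suc i j = binom-sym (suc i) j

  qfac : ℕ → Carrier
  qfac zero    = 1#
  qfac (suc j) = qfac j * (1# - pow Q (suc j))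

  -- (Q;Q)_j [n,j] is the product of the factors 1 - Q^(n-t) with t < j.
  qfac*binom : ∀ {L} → pow Q L ≈ 0# → ∀ n j → L ℕ.+ j ≤ n → qfac j * binom n j ≈ 1#
  qfac*binom {L} Q^L≈0 n zero    L+j≤n = *-identityˡ 1#
  qfac*binom {L} Q^L≈0 n (suc j) L+j≤n = begin
    qfac j * (1# - pow Q (suc j)) * binom n (suc j)   ≈⟨ *-assoc _ _ _ ⟩
    qfac j * ((1# - pow Q (suc j)) * binom n (suc j)) ≈⟨ *-congˡ (absorb n j) ⟨
    qfac j * ((1# - pow Q (n ∸ j)) * binom n j)
      ≈⟨ *-congˡ (*-congʳ (+-congˡ (-‿cong (pow-vanish L≤n∸j Q^L≈0)))) ⟩
    qfac j * ((1# - 0#) * binom n j)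
      ≈⟨ solve 2 (λ x y → x :* ((:1 :- :0) :* y) := x :* y) refl _ _ ⟩
    qfac j * binom n j
      ≈⟨ qfac*binom Q^L≈0 n j (ℕₚ.≤-trans (ℕₚ.+-monoʳ-≤ L (ℕₚ.n≤1+n j)) L+j≤n) ⟩
    1# ∎
    where
    L≤n∸j : L ≤ n ∸ j
    L≤n∸j = ℕₚ.m+n≤o⇒m≤o∸n L (ℕₚ.≤-trans (ℕₚ.+-monoʳ-≤ L (ℕₚ.n≤1+n j)) L+j≤n)

  -- The extra factors are 1 - Q^i with i > j, and Q^N Q^i = 0 for these i: in the presence of Q^N
  -- each of them acts as 1.
  qfac-truncate : ∀ {L} → pow Q L ≈ 0# → ∀ N j d → L ≤ N ℕ.+ suc j →
    qfac (j ℕ.+ d) * pow Q N ≈ qfac j * pow Q N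
  qfac-truncate Q^L≈0 N j zero    L≤ rewrite ℕₚ.+-identityʳ j = refl
  qfac-truncate Q^L≈0 N j (suc d) L≤ rewrite ℕₚ.+-suc j d = begin
    qfac (j ℕ.+ d) * (1# - s) * pow Q N
      ≈⟨ solve 3 (λ x s y → x :* (:1 :- s) :* y := x :* y :- x :* (y :* s)) refl _ _ _ ⟩
    qfac (j ℕ.+ d) * pow Q N - qfac (j ℕ.+ d) * (pow Q N * s)
      ≈⟨ +-cong (qfac-truncate Q^L≈0 N j d L≤) (-‿cong (*-congˡ tail≈0)) ⟩
    qfac j * pow Q N - qfac (j ℕ.+ d) * 0#
      ≈⟨ solve 2 (λ x y → x :- y :* :0 := x) refl _ _ ⟩
    qfac j * pow Q N ∎
    where
    s = pow Q (suc (j ℕ.+ d))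
    tail≈0 : pow Q N * s ≈ 0#
    tail≈0 = trans (sym (pow-+ Q N _))
      (pow-vanish (ℕₚ.≤-trans L≤ (ℕₚ.+-monoʳ-≤ N (s≤s (ℕₚ.m≤m+n j d)))) Q^L≈0)

  -- [2M,M-N] with its lower index reflected, so that it vanishes for N > M without subtraction.
  cb : ℕ → ℕ → Carrier
  cb M N = binom (dbl M) (M ℕ.+ N)

  cb-zero : ∀ {M N} → M < N → cb M N ≈ 0#
  cb-zero {M} {N} M<N = binom-zero
    (≡.subst (ℕ._< M ℕ.+ N) (≡.sym (dbl≡ M)) (ℕₚ.+-monoʳ-< M M<N))

  cb-shift : ∀ M N → pow Q N * (pow Q (M ∸ N) * cb M N) ≈ pow Q M * cb M N
  cb-shift M N with ℕₚ.<-≤-connex M N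
  ... | inj₁ M<N = trans (*-congˡ (trans (*-congˡ (cb-zero M<N)) (zeroʳ _)))
    (trans (zeroʳ _) (sym (trans (*-congˡ (cb-zero M<N)) (zeroʳ _))))
  ... | inj₂ N≤M = trans (sym (*-assoc _ _ _)) (*-congʳ (trans (sym (pow-+ Q N (M ∸ N)))
    (reflexive (≡.cong (pow Q) (ℕₚ.m+[n∸m]≡n N≤M)))))

  pow-dbl : ∀ M → pow Q (dbl M) ≈ pow Q M * pow Q M
  pow-dbl M = trans (reflexive (≡.cong (pow Q) (dbl≡ M))) (pow-+ Q M M)

  cb-absorb : ∀ M N →
    (1# - pow Q (M ∸ N)) * cb M N ≈ (1# - Q * (pow Q M * pow Q N)) * cb M (suc N)
  cb-absorb M N = begin
    (1# - pow Q (M ∸ N)) * cb M N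
      ≡⟨ ≡.cong (λ e → (1# - pow Q e) * cb M N) (dbl-∸ M N) ⟨
    (1# - pow Q (dbl M ∸ (M ℕ.+ N))) * cb M N
      ≈⟨ absorb (dbl M) (M ℕ.+ N) ⟩
    (1# - Q * pow Q (M ℕ.+ N)) * binom (dbl M) (suc (M ℕ.+ N))
      ≈⟨ *-cong (+-congˡ (-‿cong (*-congˡ (pow-+ Q M N))))
                (reflexive (≡.cong (binom (dbl M)) (≡.sym (ℕₚ.+-suc M N)))) ⟩
    (1# - Q * (pow Q M * pow Q N)) * cb M (suc N) ∎

  -- Raising M by one raises the upper index by two: the outer step is the defining Pascal rule, the
  -- inner one `pascal₂`. The power of Q produced in the middle term is Q^(2M+1), independent of N.
  cb-pascal : ∀ M N → cb (suc M) (suc N) ≈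
    pow Q (M ∸ N) * cb M N + (1# + Q * (pow Q M * pow Q M)) * cb M (suc N)
      + Q * Q * (pow Q M * pow Q N) * cb M (2 ℕ.+ N)
  cb-pascal M N rewrite ℕₚ.+-suc M (suc N) | ℕₚ.+-suc M N = begin
    binom (suc n) (suc k) + pow Q (2 ℕ.+ k) * binom (suc n) (2 ℕ.+ k)
      ≈⟨ +-cong (pascal₂ n k) (*-congˡ (pascal₂ n (suc k))) ⟩
    pow Q (n ∸ k) * A + B + pow Q (2 ℕ.+ k) * (pow Q (n ∸ suc k) * B + C)
      ≈⟨ solve 7 (λ Q e f s A B C → e :* A :+ B :+ Q :* (Q :* s) :* (f :* B :+ C)
               := e :* A :+ B :+ Q :* (Q :* s :* (f :* B)) :+ Q :* Q :* s :* C)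
             refl Q (pow Q (n ∸ k)) (pow Q (n ∸ suc k)) (pow Q k) A B C ⟩
    pow Q (n ∸ k) * A + B + Q * (pow Q (suc k) * (pow Q (n ∸ suc k) * B)) + Q * Q * pow Q k * C
      ≈⟨ +-cong (+-cong (+-congʳ (*-congʳ (reflexive (≡.cong (pow Q) (dbl-∸ M N)))))
                        (*-congˡ (trans (binom-shift n {suc k} ℕₚ.≤-refl) (*-congʳ (pow-dbl M)))))
                (*-congʳ (*-congˡ (pow-+ Q M N))) ⟩
    pow Q (M ∸ N) * A + B + Q * (pow Q M * pow Q M * B) + Q * Q * (pow Q M * pow Q N) * C
      ≈⟨ +-congʳ (trans (+-assoc _ _ _) (+-congˡ
           (solve 3 (λ Q x B → B :+ Q :* (x :* x :* B) := (:1 :+ Q :* (x :* x)) :* B) refl Q _ B))) ⟩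
    pow Q (M ∸ N) * A + (1# + Q * (pow Q M * pow Q M)) * B + Q * Q * (pow Q M * pow Q N) * C ∎
    where
    n = dbl M
    k = M ℕ.+ N
    A = binom n k
    B = binom n (suc k)
    C = binom n (2 ℕ.+ k)

  -- The same double step at the centre, where the neighbours on the left and on the right coincide
  -- by symmetry; hence the factor 2.
  cb-center : ∀ M → cb (suc M) 0 ≈
    (1# + Q * (pow Q M * pow Q M)) * cb M 0 + (1# + 1#) * (Q * pow Q M) * cb M 1
  cb-center M rewrite ℕₚ.+-suc M 0 | ℕₚ.+-identityʳ M = begin
    binom (suc n) M + Q * pow Q M * binom (suc n) (suc M)
      ≈⟨ +-congʳ middle ⟩
    binom (suc n) (suc M) + Q * pow Q M * binom (suc n) (suc M)
      ≈⟨ +-congˡ (*-congˡ (trans (pascal₂ n M) (+-congʳ (*-congʳ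
           (reflexive (≡.cong (pow Q) n∸M)))))) ⟩
    A + Q * pow Q M * B + Q * pow Q M * (pow Q M * A + B)
      ≈⟨ solve 4 (λ Q x A B → A :+ Q :* x :* B :+ Q :* x :* (x :* A :+ B)
               := (:1 :+ Q :* (x :* x)) :* A :+ (:1 :+ :1) :* (Q :* x) :* B) refl Q _ A B ⟩
    (1# + Q * (pow Q M * pow Q M)) * A + (1# + 1#) * (Q * pow Q M) * B ∎
    where
    n = dbl M
    A = binom n M
    B = binom n (suc M)
    n∸M : n ∸ M ≡ M
    n∸M = ≡.trans (≡.cong (_∸ M) (dbl≡ M)) (ℕₚ.m+n∸n≡m M M)
    middle : binom (suc n) M ≈ binom (suc n) (suc M)
    middle rewrite dbl≡ M = sym (binom-sym (suc M) M)

-- The finite Jacobi triple product, folded to nonnegative indices.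

module Identity {c ℓ} (R : CommutativeRing c ℓ) (a a⁻ q : CommutativeRing.Carrier R)
  (a*a⁻≈1 : CommutativeRing._≈_ R (CommutativeRing._*_ R a a⁻) (CommutativeRing.1# R)) where
  open CommutativeRing R hiding (zero)
  open QSeries R a a⁻ using (pow; neg1^; sumTo)
  open Sums R a a⁻
  open IntegerCoefficients R
  open import Relation.Binary.Reasoning.Setoid setoid

  Q : Carrier
  Q = q * q

  open QBinomial R a a⁻ Q

  w : ℕ → Carrier
  w zero    = 1#
  w (suc J) = neg1^ (suc J) * pow q (suc J ℕ.* suc J) * (pow a (suc J) + pow a⁻ (suc J))

  -- w with index lowered by one, as it enters w-rec: doubled at the boundary since a^0 + a^(-0) = 2.
  w-lower : ℕ → Carrier
  w-lower 0             = 0#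
  w-lower 1             = 1# + 1#
  w-lower (suc (suc J)) = w (suc J)

  pow-square-suc : ∀ J → pow q (suc J ℕ.* suc J) ≈ pow q (J ℕ.* J) * pow Q J * q
  pow-square-suc J = begin
    q * pow q (J ℕ.+ J ℕ.* suc J)
      ≈⟨ *-congˡ (pow-+ q J (J ℕ.* suc J)) ⟩
    q * (pow q J * pow q (J ℕ.* suc J))
      ≡⟨ ≡.cong (λ k → q * (pow q J * pow q k)) (ℕₚ.*-suc J J) ⟩
    q * (pow q J * pow q (J ℕ.+ J ℕ.* J))
      ≈⟨ *-congˡ (*-congˡ (pow-+ q J (J ℕ.* J))) ⟩
    q * (pow q J * (pow q J * pow q (J ℕ.* J)))
      ≈⟨ solve 3 (λ q x s → q :* (x :* (x :* s)) := s :* (x :* x) :* q) refl q _ _ ⟩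
    pow q (J ℕ.* J) * (pow q J * pow q J) * q
      ≈⟨ *-congʳ (*-congˡ (pow-* q q J)) ⟨
    pow q (J ℕ.* J) * pow Q J * q ∎

  -- Multiplication by a + 1/a moves the index J both up and down. The powers of q agree because J²
  -- + 2J + 1 = (J+1)² = (J-1)² + 4J.
  w-rec : ∀ J → pow Q J * (- (q * (a + a⁻) * w J)) ≈ w (suc J) + pow Q J * pow Q J * w-lower J
  w-rec 0 = solve 3 (λ q a b →
      :1 :* (:- (q :* (a :+ b) :* :1))
      := :- :1 :* :1 :* (q :* :1) :* (a :* :1 :+ b :* :1) :+ :1 :* :1 :* :0)
    refl q a a⁻
  w-rec 1 = begin
    pow Q 1 * (- (q * (a + a⁻) * w 1))
      ≈⟨ solve 3 (λ q a b →
           q :* q :* :1 :* (:- (q :* (a :+ b) :* (:- :1 :* :1 :* (q :* :1) :* (a :* :1 :+ b :* :1))))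
           := :- :1 :* (:- :1 :* :1) :* (q :* (q :* (q :* (q :* :1)))) :* (a :* (a :* :1) :+ b :* (b :* :1))
              :+ q :* q :* :1 :* (q :* q :* :1) :* (:1 :+ :1)
              :+ (:1 :+ :1) :* (q :* q :* q :* q) :* (a :* b :- :1))
         refl q a a⁻ ⟩
    w 2 + pow Q 1 * pow Q 1 * (1# + 1#) + (1# + 1#) * (q * q * q * q) * (a * a⁻ - 1#)
      ≈⟨ modulo _ _ a*a⁻≈1 ⟩
    w 2 + pow Q 1 * pow Q 1 * (1# + 1#) ∎
  w-rec (suc (suc j)) = begin
    pow Q (suc J) * (- (q * (a + a⁻) * (- 1# * s * pow q (suc J ℕ.* suc J) * (a * α + a⁻ * β))))
      ≈⟨ *-congˡ (-‿cong (*-congˡ (*-congʳ (*-congˡ (pow-square-suc J))))) ⟩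
    pow Q (suc J) * (- (q * (a + a⁻) * (- 1# * s * (S * z * q) * (a * α + a⁻ * β))))
      ≈⟨ solve 8 (λ q a b α β s S z →
           q :* q :* z :* (:- (q :* (a :+ b) :* (:- :1 :* s :* (S :* z :* q) :* (a :* α :+ b :* β))))
           := :- :1 :* (:- :1 :* s) :* (S :* z :* q :* (q :* q :* z) :* q) :* (a :* (a :* α) :+ b :* (b :* β))
              :+ q :* q :* z :* (q :* q :* z) :* (s :* S :* (α :+ β))
              :+ q :* q :* z :* (q :* q :* z) :* (s :* S :* (α :+ β)) :* (a :* b :- :1))
         refl q a a⁻ α β s S z ⟩
    - 1# * (- 1# * s) * (S * z * q * pow Q (suc J) * q) * (a * (a * α) + a⁻ * (a⁻ * β))
      + pow Q (suc J) * pow Q (suc J) * (s * S * (α + β))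
      + pow Q (suc J) * pow Q (suc J) * (s * S * (α + β)) * (a * a⁻ - 1#)
      ≈⟨ modulo _ _ a*a⁻≈1 ⟩
    - 1# * (- 1# * s) * (S * z * q * pow Q (suc J) * q) * (a * (a * α) + a⁻ * (a⁻ * β))
      + pow Q (suc J) * pow Q (suc J) * (s * S * (α + β))
      ≈⟨ +-congʳ (*-congʳ (*-congˡ (trans (pow-square-suc (suc J))
           (*-congʳ (*-congʳ (pow-square-suc J)))))) ⟨
    w (suc (suc J)) + pow Q (suc J) * pow Q (suc J) * w J ∎
    where
    J = suc j
    s = neg1^ J
    α = pow a J
    β = pow a⁻ J
    S = pow q (J ℕ.* J)
    z = pow Q J

  jacobi : ℕ → Carrier
  jacobi zero    = 1#
  jacobi (suc M) = jacobi M * ((1# - a * (q * pow Q M)) * (1# - a⁻ * (q * pow Q M)))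

  jacobiSum : ℕ → Carrier
  jacobiSum M = sumTo M (λ J → cb M J * w J)

  sumTo-cb : ∀ M d (f : ℕ → Carrier) →
    sumTo (M ℕ.+ d) (λ J → cb M J * f J) ≈ sumTo M (λ J → cb M J * f J)
  sumTo-cb M d f = sumTo-extend M d (λ J M<J → trans (*-congʳ (cb-zero M<J)) (zeroˡ _))

  -- `cb M J` vanishes for J > M, so a first term can be split off without shortening the remaining
  -- range.
  sumTo-cb-suc : ∀ M (f : ℕ → Carrier) →
    sumTo M (λ J → cb M J * f J) ≈ cb M 0 * f 0 + sumTo M (λ J → cb M (suc J) * f (suc J))
  sumTo-cb-suc M f = begin
    sumTo M (λ J → cb M J * f J)          ≈⟨ sumTo-cb M 1 f ⟨
    sumTo (M ℕ.+ 1) (λ J → cb M J * f J)  ≡⟨ ≡.cong (λ k → sumTo k (λ J → cb M J * f J)) (ℕₚ.+-comm M 1) ⟩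
    sumTo (suc M) (λ J → cb M J * f J)    ≈⟨ sumTo-shift M _ ⟩
    cb M 0 * f 0 + sumTo M (λ J → cb M (suc J) * f (suc J)) ∎

  sumTo-cb-suc² : ∀ M (f : ℕ → Carrier) →
    sumTo M (λ J → cb M J * f J)
      ≈ cb M 0 * f 0 + (cb M 1 * f 1 + sumTo M (λ J → cb M (2 ℕ.+ J) * f (2 ℕ.+ J)))
  sumTo-cb-suc² M f = trans (sumTo-cb-suc M f) (+-congˡ (begin
    sumTo M g                ≈⟨ +-identityʳ _ ⟨
    sumTo M g + 0#           ≈⟨ +-congˡ (trans (*-congʳ (cb-zero (s≤s (ℕₚ.n≤1+n M)))) (zeroˡ _)) ⟨
    sumTo (suc M) g          ≈⟨ sumTo-shift M g ⟩
    g 0 + sumTo M (λ J → g (suc J)) ∎))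
    where
    g : ℕ → Carrier
    g J = cb M (suc J) * f (suc J)

  -- Regrouped by central binomials of level M, the coefficient of `cb M J` is Q^(M-J) w_(J+1) + (1
  -- + Q^(2M+1)) w_J + Q^(M+J) w_(J-1), with `w-lower` for the last w. By `w-rec` the outer terms
  -- combine to -q (a + 1/a) Q^M w_J, the linear part of the new quadratic factor.
  jacobiSum-suc : ∀ M → jacobiSum (suc M)
    ≈ jacobiSum M * ((1# - a * (q * pow Q M)) * (1# - a⁻ * (q * pow Q M)))
  jacobiSum-suc M = begin
    sumTo (suc M) (λ J → cb (suc M) J * w J)
      ≈⟨ sumTo-shift M _ ⟩
    cb (suc M) 0 * 1# + sumTo M (λ N → cb (suc M) (suc N) * w (suc N))
      ≈⟨ +-cong (*-congʳ (cb-center M)) (trans (sumTo-cong M expand) (trans (sumTo-+ M _ _)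
           (+-congʳ (sumTo-+ M _ _)))) ⟩
    (k * cb M 0 + (1# + 1#) * (Q * x) * cb M 1) * 1#
      + (sumTo M up + sumTo M (λ N → cb M (suc N) * (k * w (suc N)))
         + sumTo M (λ N → cb M (2 ℕ.+ N) * lower (2 ℕ.+ N)))
      -- The terms of `lower` at 0 and 1 are supplied here: the first is zero, and the second is the
      -- doubled neighbour from `cb-center`.
      ≈⟨ solve 8 (λ k Q x c c′ u v t → (k :* c :+ (:1 :+ :1) :* (Q :* x) :* c′) :* :1 :+ (u :+ v :+ t)
               := u :+ (c :* (k :* :1) :+ v) :+ (c :* (x :* :1 :* :0) :+ (c′ :* (x :* (Q :* :1) :* (:1 :+ :1)) :+ t)))
           refl k Q x (cb M 0) (cb M 1) _ _ _ ⟩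
    sumTo M up
      + (cb M 0 * (k * w 0) + sumTo M (λ N → cb M (suc N) * (k * w (suc N))))
      + (cb M 0 * lower 0 + (cb M 1 * lower 1 + sumTo M (λ N → cb M (2 ℕ.+ N) * lower (2 ℕ.+ N))))
      ≈⟨ +-cong (+-congˡ (sumTo-cb-suc M (λ J → k * w J))) (sumTo-cb-suc² M lower) ⟨
    sumTo M up + sumTo M (λ J → cb M J * (k * w J)) + sumTo M (λ J → cb M J * lower J)
      ≈⟨ trans (sumTo-+ M _ _) (+-congʳ (sumTo-+ M _ _)) ⟨
    sumTo M (λ J → up J + cb M J * (k * w J) + cb M J * lower J)
      ≈⟨ sumTo-cong M collect ⟩
    sumTo M (λ J → cb M J * w J * ((1# - a * (q * x)) * (1# - a⁻ * (q * x))))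
      ≈⟨ sumTo-*ʳ M _ _ ⟨
    jacobiSum M * ((1# - a * (q * x)) * (1# - a⁻ * (q * x))) ∎
    where
    x = pow Q M
    k = 1# + Q * (x * x)
    up lower : ℕ → Carrier
    up N = pow Q (M ∸ N) * cb M N * w (suc N)
    lower J = x * pow Q J * w-lower J
    expand : ∀ N → cb (suc M) (suc N) * w (suc N) ≈
      up N + cb M (suc N) * (k * w (suc N)) + cb M (2 ℕ.+ N) * lower (2 ℕ.+ N)
    expand N = trans (*-congʳ (cb-pascal M N))
      (solve 9 (λ Q x y e A B C w k → (e :* A :+ k :* B :+ Q :* Q :* (x :* y) :* C) :* w
               := e :* A :* w :+ B :* (k :* w) :+ C :* (x :* (Q :* (Q :* y)) :* w))
             refl Q x (pow Q N) (pow Q (M ∸ N)) (cb M N) (cb M (suc N)) (cb M (2 ℕ.+ N)) (w (suc N)) k)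
    collect : ∀ J → up J + cb M J * (k * w J) + cb M J * lower J
      ≈ cb M J * w J * ((1# - a * (q * x)) * (1# - a⁻ * (q * x)))
    collect J = begin
      e * A * w (suc J) + A * (k * w J) + A * (x * y * w-lower J)
        ≈⟨ solve 8 (λ e A w₊ w₋ k v x y → e :* A :* w₊ :+ A :* (k :* v) :+ A :* (x :* y :* w₋)
                 := e :* A :* w₊ :+ y :* w₋ :* (x :* A) :+ A :* (k :* v))
             refl e A (w (suc J)) (w-lower J) k (w J) x y ⟩
      e * A * w (suc J) + y * w-lower J * (x * A) + A * (k * w J)
        ≈⟨ +-congʳ (+-congˡ (*-congˡ (cb-shift M J))) ⟨
      e * A * w (suc J) + y * w-lower J * (y * (e * A)) + A * (k * w J)
        ≈⟨ solve 7 (λ e A w₊ w₋ k v y → e :* A :* w₊ :+ y :* w₋ :* (y :* (e :* A)) :+ A :* (k :* v)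
                 := e :* A :* (w₊ :+ y :* y :* w₋) :+ A :* (k :* v))
             refl e A (w (suc J)) (w-lower J) k (w J) y ⟩
      e * A * (w (suc J) + y * y * w-lower J) + A * (k * w J)
        ≈⟨ +-congʳ (*-congˡ (w-rec J)) ⟨
      e * A * (y * (- (q * (a + a⁻) * w J))) + A * (k * w J)
        ≈⟨ solve 8 (λ e A y q a b v k → e :* A :* (y :* (:- (q :* (a :+ b) :* v))) :+ A :* (k :* v)
                 := :- (q :* (a :+ b) :* v) :* (y :* (e :* A)) :+ A :* (k :* v))
             refl e A y q a a⁻ (w J) k ⟩
      - (q * (a + a⁻) * w J) * (y * (e * A)) + A * (k * w J)
        ≈⟨ +-congʳ (*-congˡ (cb-shift M J)) ⟩
      - (q * (a + a⁻) * w J) * (x * A) + A * (k * w J)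
        -- The added multiple of a a⁻ - 1 turns the constant part Q x² into a a⁻ q² x², so that the
        -- quadratic factors.
        ≈⟨ modulo _ _ a*a⁻≈1 ⟨
      - (q * (a + a⁻) * w J) * (x * A) + A * (k * w J) + q * q * x * x * A * w J * (a * a⁻ - 1#)
        ≈⟨ solve 6 (λ q a b v x A → :- (q :* (a :+ b) :* v) :* (x :* A) :+ A :* ((:1 :+ q :* q :* (x :* x)) :* v)
                       :+ q :* q :* x :* x :* A :* v :* (a :* b :- :1)
                 := A :* v :* ((:1 :- a :* (q :* x)) :* (:1 :- b :* (q :* x))))
             refl q a a⁻ (w J) x A ⟩
      A * w J * ((1# - a * (q * x)) * (1# - a⁻ * (q * x))) ∎
      where
      e = pow Q (M ∸ J)
      A = cb M J
      y = pow Q J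

  jacobi≈jacobiSum : ∀ M → jacobi M ≈ jacobiSum M
  jacobi≈jacobiSum zero    = sym (*-identityˡ 1#)
  jacobi≈jacobiSum (suc M) = trans (*-congʳ (jacobi≈jacobiSum M)) (sym (jacobiSum-suc M))

  -- The weights W and the telescoping sum F.

  cube : ℕ → Carrier
  cube N = Q * Q * Q * (pow Q N * pow Q N * pow Q N)

  -- W N = Σ (-1)^((N+J)/2) a^J q^((3N²-J²)/2), over |J| ≤ N with J ≡ N (mod 2).
  W : ℕ → Carrier
  W 0             = w 0
  W 1             = w 1
  W (suc (suc N)) = w (suc (suc N)) - cube N * W N

  -- The term Q^(3N-3) W_(N-2) at index N, zero where N-2 is negative. The exponent of `cube` is
  -- shifted by two accordingly: `cube N` is Q^(3N+3).
  W-lower : ℕ → Carrier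
  W-lower 0             = 0#
  W-lower 1             = 0#
  W-lower (suc (suc N)) = cube N * W N

  W+W-lower : ∀ N → W N + W-lower N ≈ w N
  W+W-lower 0             = +-identityʳ _
  W+W-lower 1             = +-identityʳ _
  W+W-lower (suc (suc N)) = solve 2 (λ x y → x :- y :+ y := x) refl _ _

  term : ℕ → Carrier
  term N = pow Q N * (1# + Q * pow Q N) * W N

  F : ℕ → Carrier
  F M = sumTo M (λ N → cb M (suc N) * term N)

  -- After `cb-pascal` the left side is linear in three neighbouring central binomials. Shift and
  -- absorption relations tie these together and eliminate Q^(M-N); the weight Q^N (1 + Q^(N+1)) is
  -- what lets 1 + Q^(M+1) come out as a common factor.
  cb-contiguous : ∀ M N →
    cb (suc M) (suc N) * (pow Q N * (1# + Q * pow Q N))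
      ≈ (1# + Q * pow Q M) * (cb M (suc N) * (pow Q N * (1# + Q * pow Q N)))
        + pow Q M * (1# + Q * pow Q M) * (cb M N + cb M (2 ℕ.+ N) * cube N)
  cb-contiguous M N = begin
    cb (suc M) (suc N) * g
      ≈⟨ *-congʳ (cb-pascal M N) ⟩
    (e * A + (1# + Q * (x * x)) * B + Q * Q * (x * y) * C) * g
      -- A certificate: the two sides differ by an explicit combination of four relations, namely
      -- `cb-shift` and `cb-absorb` at N and at N+1. Each `modulo` below discards one of them.
      ≈⟨ solve 8 (λ Q x y e f A B C →
           (e :* A :+ (:1 :+ Q :* (x :* x)) :* B :+ Q :* Q :* (x :* y) :* C) :* (y :* (:1 :+ Q :* y))
           := (:1 :+ Q :* x) :* (B :* (y :* (:1 :+ Q :* y)))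
              :+ x :* (:1 :+ Q :* x) :* (A :+ C :* (Q :* Q :* Q :* (y :* y :* y)))
              :+ (:1 :+ Q :* y :+ Q :* x) :* (y :* (e :* A) :- x :* A)
              :+ Q :* x :* y :* ((:1 :- e) :* A :- (:1 :- Q :* (x :* y)) :* B)
              :+ :- (Q :* Q :* x :* y :* y) :* ((:1 :- f) :* B :- (:1 :- Q :* (x :* (Q :* y))) :* C)
              :+ :- (Q :* x :* y) :* (Q :* y :* (f :* B) :- x :* B))
           refl Q x y e f A B C ⟩
    (1# + Q * x) * (B * g) + x * (1# + Q * x) * (A + C * cube N)
      + (1# + Q * y + Q * x) * (y * (e * A) - x * A)
      + Q * x * y * ((1# - e) * A - (1# - Q * (x * y)) * B)
      + - (Q * Q * x * y * y) * ((1# - f) * B - (1# - Q * (x * (Q * y))) * C)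
      + - (Q * x * y) * (Q * y * (f * B) - x * B)
      ≈⟨ modulo _ _ (cb-shift M (suc N)) ⟩
    (1# + Q * x) * (B * g) + x * (1# + Q * x) * (A + C * cube N)
      + (1# + Q * y + Q * x) * (y * (e * A) - x * A)
      + Q * x * y * ((1# - e) * A - (1# - Q * (x * y)) * B)
      + - (Q * Q * x * y * y) * ((1# - f) * B - (1# - Q * (x * (Q * y))) * C)
      ≈⟨ modulo _ _ (cb-absorb M (suc N)) ⟩
    (1# + Q * x) * (B * g) + x * (1# + Q * x) * (A + C * cube N)
      + (1# + Q * y + Q * x) * (y * (e * A) - x * A)
      + Q * x * y * ((1# - e) * A - (1# - Q * (x * y)) * B)
      ≈⟨ modulo _ _ (cb-absorb M N) ⟩
    (1# + Q * x) * (B * g) + x * (1# + Q * x) * (A + C * cube N)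
      + (1# + Q * y + Q * x) * (y * (e * A) - x * A)
      ≈⟨ modulo _ _ (cb-shift M N) ⟩
    (1# + Q * x) * (B * g) + x * (1# + Q * x) * (A + C * cube N) ∎
    where
    x = pow Q M
    y = pow Q N
    g = y * (1# + Q * y)
    e = pow Q (M ∸ N)
    f = pow Q (M ∸ suc N)
    A = cb M N
    B = cb M (suc N)
    C = cb M (2 ℕ.+ N)

  -- Shifting the `cube` part of `cb-contiguous` by two collects W_N + Q^(3N-3) W_(N-2) = w_N at
  -- [2M,M+N], which is the Jacobi sum.
  F-suc : ∀ M → F (suc M) ≈ (1# + Q * pow Q M) * (F M + pow Q M * jacobi M)
  F-suc M = begin
    sumTo M (λ N → cb (suc M) (suc N) * term N) + cb (suc M) (2 ℕ.+ M) * term (suc M)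
      ≈⟨ +-cong (sumTo-cong M expand) (trans (*-congʳ (cb-zero {suc M} ℕₚ.≤-refl)) (zeroˡ _)) ⟩
    sumTo M (λ N → k * (cb M (suc N) * term N)
                   + x * k * (cb M N * W N + cb M (2 ℕ.+ N) * W-lower (2 ℕ.+ N))) + 0#
      ≈⟨ trans (+-identityʳ _) (trans (sumTo-+ M _ _)
           (+-cong (sym (sumTo-*ˡ M k _)) (trans (sym (sumTo-*ˡ M (x * k) _)) (*-congˡ (sumTo-+ M _ _))))) ⟩
    k * F M + x * k * (sumTo M (λ N → cb M N * W N) + sumTo M (λ N → cb M (2 ℕ.+ N) * W-lower (2 ℕ.+ N)))
      ≈⟨ +-congˡ (*-congˡ (+-congˡ (trans (sumTo-cb-suc² M W-lower)
           (solve 3 (λ x y z → x :* :0 :+ (y :* :0 :+ z) := z) refl _ _ _)))) ⟨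
    k * F M + x * k * (sumTo M (λ N → cb M N * W N) + sumTo M (λ N → cb M N * W-lower N))
      ≈⟨ +-congˡ (*-congˡ (trans (sym (sumTo-+ M _ _)) (sumTo-cong M (λ N →
           trans (sym (distribˡ _ _ _)) (*-congˡ (W+W-lower N)))))) ⟩
    k * F M + x * k * jacobiSum M
      ≈⟨ +-congˡ (*-congˡ (jacobi≈jacobiSum M)) ⟨
    k * F M + x * k * jacobi M
      ≈⟨ solve 4 (λ k f x j → k :* f :+ x :* k :* j := k :* (f :+ x :* j)) refl k _ x _ ⟩
    k * (F M + x * jacobi M) ∎
    where
    x = pow Q M
    k = 1# + Q * x
    expand : ∀ N → cb (suc M) (suc N) * term N ≈
      k * (cb M (suc N) * term N) + x * k * (cb M N * W N + cb M (2 ℕ.+ N) * W-lower (2 ℕ.+ N))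
    expand N = begin
      cb (suc M) (suc N) * (g * W N)    ≈⟨ *-assoc _ _ _ ⟨
      cb (suc M) (suc N) * g * W N      ≈⟨ *-congʳ (cb-contiguous M N) ⟩
      (k * (B * g) + x * k * (A + C * cube N)) * W N
        ≈⟨ solve 8 (λ k x g A B C d v → (k :* (B :* g) :+ x :* k :* (A :+ C :* d)) :* v
                 := k :* (B :* (g :* v)) :+ x :* k :* (A :* v :+ C :* (d :* v)))
             refl k x g A B C (cube N) (W N) ⟩
      k * (B * (g * W N)) + x * k * (A * W N + C * (cube N * W N)) ∎
      where
      g = pow Q N * (1# + Q * pow Q N)
      A = cb M N
      B = cb M (suc N)
      C = cb M (2 ℕ.+ N)

  -- Partial sums of S, and the limit modulo a power of Q.

  minusPoch : ℕ → Carrier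
  minusPoch zero    = 1#
  minusPoch (suc M) = minusPoch M * (1# + Q * pow Q M)

  -- Put M = K+1 and d = K-N. Reflected, the binomial is [2M,d]. The factor Q^N of the term reduces
  -- (Q;Q)_M to (Q;Q)_d, and (Q;Q)_d [2M,d] is a product of factors 1 - Q^i with i > M, all equal to
  -- 1.
  qfac*F : ∀ K → pow Q (suc K) ≈ 0# → qfac (suc K) * F (suc K) ≈ sumTo K term
  qfac*F K Q^≈0 = begin
    qfac M * (sumTo K t + t (suc K))
      ≈⟨ *-congˡ (trans (+-congˡ (trans (*-congʳ (cb-zero (ℕₚ.n<1+n M))) (zeroˡ _))) (+-identityʳ _)) ⟩
    qfac M * sumTo K t
      ≈⟨ sumTo-*ˡ K _ _ ⟩
    sumTo K (λ N → qfac M * t N)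
      ≈⟨ sumTo-cong-≤ K simplify ⟩
    sumTo K term ∎
    where
    M = suc K
    t : ℕ → Carrier
    t N = cb M (suc N) * term N
    cb≈binom : ∀ N d → N ℕ.+ d ≡ K → cb M (suc N) ≈ binom (dbl M) d
    cb≈binom N d N+d≡K = trans (reflexive (≡.cong (λ n → binom n (M ℕ.+ suc N)) (≡.sym i+d≡)))
      (trans (binom-sym (M ℕ.+ suc N) d) (reflexive (≡.cong (λ n → binom n d) i+d≡)))
      where
      i+d≡ : M ℕ.+ suc N ℕ.+ d ≡ dbl M
      i+d≡ = ≡.trans (ℕₚ.+-assoc M (suc N) d)
        (≡.trans (≡.cong (λ k → M ℕ.+ suc k) N+d≡K) (≡.sym (dbl≡ M)))
    simplify : ∀ N → N ≤ K → qfac M * t N ≈ term N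
    simplify N N≤K = begin
      qfac M * (cb M (suc N) * (y * g * W N))
        ≈⟨ *-congˡ (*-congʳ (cb≈binom N d (ℕₚ.m+[n∸m]≡n N≤K))) ⟩
      qfac M * (b * (y * g * W N))
        ≈⟨ solve 5 (λ f b y g v → f :* (b :* (y :* g :* v)) := f :* y :* (b :* g :* v)) refl _ _ _ _ _ ⟩
      qfac M * y * (b * g * W N)
        ≡⟨ ≡.cong (λ n → qfac n * y * (b * g * W N)) M≡ ⟨
      qfac (d ℕ.+ suc N) * y * (b * g * W N)
        ≈⟨ *-congʳ (qfac-truncate Q^≈0 N d (suc N) (ℕₚ.≤-reflexive (≡.sym (≡.trans (ℕₚ.+-suc N d)
             (≡.cong suc (ℕₚ.m+[n∸m]≡n N≤K)))))) ⟩
      qfac d * y * (b * g * W N)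
        ≈⟨ solve 5 (λ f b y g v → f :* y :* (b :* g :* v) := f :* b :* (y :* g :* v)) refl _ _ _ _ _ ⟩
      qfac d * b * (y * g * W N)
        ≈⟨ *-congʳ (qfac*binom Q^≈0 (dbl M) d M+d≤) ⟩
      1# * (y * g * W N)
        ≈⟨ *-identityˡ _ ⟩
      y * g * W N ∎
      where
      d = K ∸ N
      y = pow Q N
      g = 1# + Q * y
      b = binom (dbl M) d
      M≡ : d ℕ.+ suc N ≡ M
      M≡ = ≡.trans (ℕₚ.+-suc d N) (≡.cong suc (ℕₚ.m∸n+n≡m N≤K))
      M+d≤ : M ℕ.+ d ≤ dbl M
      M+d≤ rewrite dbl≡ M = ℕₚ.+-monoʳ-≤ M (ℕₚ.≤-trans (ℕₚ.m∸n≤m K N) (ℕₚ.n≤1+n K))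

  squarePoch : ℕ → Carrier
  squarePoch zero    = 1#
  squarePoch (suc M) = squarePoch M * (1# - pow Q (suc M) * pow Q (suc M))

  -- The product on the left is (q^4;q^4)_M, the finite form of the prefactor of S, and 1 - x² = (1
  -- - x)(1 + x) factor by factor.
  squarePoch≈ : ∀ M → squarePoch M ≈ qfac M * minusPoch M
  squarePoch≈ zero    = sym (*-identityˡ 1#)
  squarePoch≈ (suc M) = trans (*-congʳ (squarePoch≈ M))
    (solve 4 (λ f m Q x → f :* m :* (:1 :- Q :* x :* (Q :* x)) := f :* (:1 :- Q :* x) :* (m :* (:1 :+ Q :* x)))
       refl _ _ Q _)

  module _ (inv : ℕ → Carrier) (inverse : ∀ m → minusPoch m * inv m ≈ 1#) where

    partial : ℕ → Carrier
    partial M = sumTo M (λ m → jacobi m * pow Q m * inv m)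

    minusPoch*term : ∀ M → minusPoch M * (jacobi M * pow Q M * inv M) ≈ pow Q M * jacobi M
    minusPoch*term M = trans
      (solve 4 (λ p j x i → p :* (j :* x :* i) := p :* i :* (x :* j)) refl _ _ _ _)
      (trans (*-congʳ (inverse M)) (*-identityˡ _))

    -- Clearing denominators turns each new summand into Q^M `jacobi M`, exactly the inhomogeneous
    -- part of `F-suc`. The induction alternates with `step`.
    minusPoch*partial : ∀ M → minusPoch (suc M) * partial M ≈ F (suc M)
    minusPoch*partial M = begin
      minusPoch M * k M * partial M     ≈⟨ solve 3 (λ p k s → p :* k :* s := k :* (p :* s)) refl _ _ _ ⟩
      k M * (minusPoch M * partial M)   ≈⟨ *-congˡ (step M) ⟩
      k M * (F M + pow Q M * jacobi M)  ≈⟨ F-suc M ⟨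
      F (suc M) ∎
      where
      k : ℕ → Carrier
      k M = 1# + Q * pow Q M
      step : ∀ M → minusPoch M * partial M ≈ F M + pow Q M * jacobi M
      -- The recursion starts from zero: `F 0` contains only `cb 0 1`, which is 0.
      step zero    = trans (minusPoch*term 0)
        (solve 1 (λ t → :1 :* :1 := :0 :* t :+ :1 :* :1) refl (term 0))
      step (suc M) = trans (distribˡ _ _ _) (+-cong (minusPoch*partial M) (minusPoch*term (suc M)))

    squarePoch*partial : ∀ K → pow Q (suc K) ≈ 0# → squarePoch (suc K) * partial K ≈ sumTo K term
    squarePoch*partial K Q^≈0 = begin
      squarePoch (suc K) * partial K                ≈⟨ *-congʳ (squarePoch≈ (suc K)) ⟩
      qfac (suc K) * minusPoch (suc K) * partial K  ≈⟨ *-assoc _ _ _ ⟩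
      qfac (suc K) * (minusPoch (suc K) * partial K) ≈⟨ *-congˡ (minusPoch*partial K) ⟩
      qfac (suc K) * F (suc K)                      ≈⟨ qfac*F K Q^≈0 ⟩
      sumTo K term ∎

-- Arithmetic of the exponents in the two double sums.

dbl≡2* : ∀ n → dbl n ≡ 2 ℕ.* n
dbl≡2* n = ≡.trans (dbl≡ n) (≡.cong (n ℕ.+_) (≡.sym (ℕₚ.+-identityʳ n)))

∣i-n∣≤n : ∀ n i → i ≤ 2 ℕ.* n → ∣ + i ℤ.- + n ∣ ≤ n
∣i-n∣≤n n i i≤2n rewrite ℤₚ.m-n≡m⊖n i n with ℕₚ.≤-total i n
... | inj₁ i≤n = ≡.subst (ℕ._≤ n) (≡.sym (ℤₚ.∣⊖∣-≤ i≤n)) (ℕₚ.m∸n≤m n i)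
... | inj₂ n≤i rewrite ℤₚ.⊖-≥ n≤i = ℕₚ.≤-trans (ℕₚ.∸-monoˡ-≤ n i≤2n)
  (ℕₚ.≤-reflexive (≡.trans (ℕₚ.m+n∸m≡n n (n ℕ.+ 0)) (ℕₚ.+-identityʳ n)))

module Exponents where
  open +-*-Solver using (solve; con; _:*_; _:+_; _:=_)
  open import Data.Nat.Base using (_+_; _*_)

  2kk≤6nn : ∀ {k n} → k ≤ n → 2 * k * k ≤ 6 * n * n
  2kk≤6nn k≤n = ℕₚ.*-mono-≤ (ℕₚ.*-mono-≤ {2} {6} (s≤s (s≤s z≤n)) k≤n) k≤n

  -- The increment 12n + 6 is the q-exponent of `cube (dbl n)`, the factor in the recursion for W.
  -- The bound on s keeps the subtraction exact.
  even-suc : ∀ n {s} → s ≤ 6 * n * n →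
    6 * suc n * suc n ∸ s ≡ 6 + 6 * dbl n + (6 * n * n ∸ s)
  even-suc n {s} s≤ rewrite dbl≡ n = ≡.trans
    (≡.cong (_∸ s) (solve 1 (λ n → con 6 :* (con 1 :+ n) :* (con 1 :+ n)
       := con 6 :+ con 6 :* (n :+ n) :+ con 6 :* n :* n) ≡.refl n))
    (ℕₚ.+-∸-assoc (6 + 6 * (n + n)) s≤)

  even-end : ∀ n → 6 * n * n ∸ 2 * n * n ≡ dbl n * dbl n
  even-end n rewrite dbl≡ n = ≡.trans
    (≡.cong (_∸ 2 * n * n) (solve 1 (λ n → con 6 :* n :* n
       := (n :+ n) :* (n :+ n) :+ con 2 :* n :* n) ≡.refl n))
    (ℕₚ.m+n∸n≡m ((n + n) * (n + n)) (2 * n * n))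

  -- With N = 2n, the factors Q^N and Q^(2N+1) of a term raise the exponent of W_N by 2N here and by
  -- 4N + 2 in `even-high`.
  even-low : ∀ n → 6 * n * n + 2 * dbl n ≡ 6 * n * n + 4 * n
  even-low n rewrite dbl≡ n = solve 1 (λ n →
    con 6 :* n :* n :+ con 2 :* (n :+ n) := con 6 :* n :* n :+ con 4 :* n) ≡.refl n

  even-high : ∀ n →
    6 * n * n + 2 * dbl n + (2 + 2 * dbl n) ≡ 6 * n * n + 4 * n + (4 * n + 2)
  even-high n rewrite dbl≡ n = solve 1 (λ n →
    con 6 :* n :* n :+ con 2 :* (n :+ n) :+ (con 2 :+ con 2 :* (n :+ n))
    := con 6 :* n :* n :+ con 4 :* n :+ (con 4 :* n :+ con 2)) ≡.refl n

  -- This is (3N² - 1)/2 for N = 2n+1, the largest q-exponent in W_N.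
  oddExp : ℕ → ℕ
  oddExp n = 6 * n * n + 6 * n + 1

  2jj+2j≤oddExp : ∀ {j n} → j ≤ n → 2 * j * (j + 1) ≤ oddExp n
  2jj+2j≤oddExp {j} {n} j≤n = ℕₚ.≤-trans
    (ℕₚ.*-mono-≤ (ℕₚ.*-monoʳ-≤ 2 j≤n) (ℕₚ.+-monoˡ-≤ 1 j≤n))
    (≡.subst (2 * n * (n + 1) ℕ.≤_)
      (solve 1 (λ n → con 2 :* n :* (n :+ con 1) :+ (con 4 :* n :* n :+ con 4 :* n :+ con 1)
        := con 6 :* n :* n :+ con 6 :* n :+ con 1) ≡.refl n)
      (ℕₚ.m≤m+n _ (4 * n * n + 4 * n + 1)))

  odd-suc : ∀ n {s} → s ≤ oddExp n →
    oddExp (suc n) ∸ s ≡ 6 + 6 * suc (dbl n) + (oddExp n ∸ s)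
  odd-suc n {s} s≤ rewrite dbl≡ n = ≡.trans
    (≡.cong (_∸ s) (solve 1 (λ n →
       con 6 :* (con 1 :+ n) :* (con 1 :+ n) :+ con 6 :* (con 1 :+ n) :+ con 1
       := con 6 :+ con 6 :* (con 1 :+ (n :+ n)) :+ (con 6 :* n :* n :+ con 6 :* n :+ con 1)) ≡.refl n))
    (ℕₚ.+-∸-assoc (6 + 6 * suc (n + n)) s≤)

  odd-end : ∀ n → oddExp n ∸ 2 * n * (n + 1) ≡ suc (dbl n) * suc (dbl n)
  odd-end n rewrite dbl≡ n = ≡.trans
    (≡.cong (_∸ 2 * n * (n + 1)) (solve 1 (λ n → con 6 :* n :* n :+ con 6 :* n :+ con 1
       := (con 1 :+ (n :+ n)) :* (con 1 :+ (n :+ n)) :+ con 2 :* n :* (n :+ con 1)) ≡.refl n))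
    (ℕₚ.m+n∸n≡m (suc (n + n) * suc (n + n)) (2 * n * (n + 1)))

  odd-low : ∀ n → oddExp n + 2 * suc (dbl n) ≡ 6 * n * n + 10 * n + 3
  odd-low n rewrite dbl≡ n = solve 1 (λ n →
    con 6 :* n :* n :+ con 6 :* n :+ con 1 :+ con 2 :* (con 1 :+ (n :+ n))
    := con 6 :* n :* n :+ con 10 :* n :+ con 3) ≡.refl n

  odd-high : ∀ n → oddExp n + 2 * suc (dbl n) + (2 + 2 * suc (dbl n))
    ≡ 6 * n * n + 10 * n + 3 + (4 * n + 4)
  odd-high n rewrite dbl≡ n = solve 1 (λ n →
    con 6 :* n :* n :+ con 6 :* n :+ con 1 :+ con 2 :* (con 1 :+ (n :+ n))
      :+ (con 2 :+ con 2 :* (con 1 :+ (n :+ n)))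
    := con 6 :* n :* n :+ con 10 :* n :+ con 3 :+ (con 4 :* n :+ con 4)) ≡.refl n

-- Closed forms of W at even and odd indices.

module Explicit {c ℓ} (R : CommutativeRing c ℓ) (a a⁻ q : CommutativeRing.Carrier R)
  (a*a⁻≈1 : CommutativeRing._≈_ R (CommutativeRing._*_ R a a⁻) (CommutativeRing.1# R)) where
  open CommutativeRing R hiding (zero)
  open QSeries R a a⁻ using (pow; neg1^; apow; sumTo)
  open Sums R a a⁻
  open IntegerCoefficients R
  open Identity R a a⁻ q a*a⁻≈1
  open Exponents
  open import Relation.Binary.Reasoning.Setoid setoid

  sumTo-symmetric-suc : ∀ n (g : ℤ → Carrier) →
    sumTo (2 ℕ.* suc n) (λ i → g (+ i ℤ.- + suc n))
      ≈ sumTo (2 ℕ.* n) (λ i → g (+ i ℤ.- + n)) + (g (+ suc n) + g -[1+ n ])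
  sumTo-symmetric-suc n g rewrite ℕₚ.+-suc n (n ℕ.+ 0) = begin
    sumTo (suc (2 ℕ.* n)) f + f (suc (suc (2 ℕ.* n)))
      ≈⟨ +-cong (sumTo-shift (2 ℕ.* n) f) (reflexive (≡.cong g last)) ⟩
    f 0 + sumTo (2 ℕ.* n) (λ i → f (suc i)) + g (+ suc n)
      ≈⟨ +-congʳ (+-congˡ (sumTo-cong (2 ℕ.* n) (λ i → reflexive (≡.cong g (shift i))))) ⟩
    g -[1+ n ] + sumTo (2 ℕ.* n) (λ i → g (+ i ℤ.- + n)) + g (+ suc n)
      ≈⟨ solve 3 (λ x s y → x :+ s :+ y := s :+ (y :+ x)) refl _ _ _ ⟩
    sumTo (2 ℕ.* n) (λ i → g (+ i ℤ.- + n)) + (g (+ suc n) + g -[1+ n ]) ∎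
    where
    f : ℕ → Carrier
    f i = g (+ i ℤ.- + suc n)
    shift : ∀ i → + suc i ℤ.- + suc n ≡ + i ℤ.- + n
    shift i = ≡.trans (ℤₚ.[1+m]⊖[1+n]≡m⊖n i n) (≡.sym (ℤₚ.m-n≡m⊖n i n))
    1+2n≡ : suc (2 ℕ.* n) ≡ suc n ℕ.+ n
    1+2n≡ = ≡.cong (λ k → suc (n ℕ.+ k)) (ℕₚ.+-identityʳ n)
    last : + suc (suc (2 ℕ.* n)) ℤ.- + suc n ≡ + suc n
    last = ≡.trans (shift (suc (2 ℕ.* n))) (≡.trans (≡.cong (λ k → + k ℤ.- + n) 1+2n≡)
      (≡.trans (ℤₚ.m-n≡m⊖n (suc n ℕ.+ n) n) (≡.trans (ℤₚ.⊖-≥ (ℕₚ.m≤n+m n (suc n)))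
        (≡.cong +_ (ℕₚ.m+n∸n≡m (suc n) n)))))

  pow-Q : ∀ N → pow Q N ≈ pow q (2 ℕ.* N)
  pow-Q N = trans (pow-* q q N) (trans (*-congˡ (sym (*-identityʳ _))) (sym (pow-*ℕ q 2 N)))

  cube≈ : ∀ N → cube N ≈ pow q (6 ℕ.+ 6 ℕ.* N)
  cube≈ N = begin
    Q * Q * Q * (pow Q N * pow Q N * pow Q N)
      ≈⟨ *-congˡ (*-cong (*-cong (pow-* q q N) (pow-* q q N)) (pow-* q q N)) ⟩
    Q * Q * Q * (z * z * (z * z) * (z * z))
      ≈⟨ solve 2 (λ q z → q :* q :* (q :* q) :* (q :* q) :* (z :* z :* (z :* z) :* (z :* z))
           := q :* (q :* (q :* (q :* (q :* (q :* (z :* (z :* (z :* (z :* (z :* (z :* :1))))))))))))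
           refl q z ⟩
    q * (q * (q * (q * (q * (q * pow z 6)))))
      ≈⟨ *-congˡ (*-congˡ (*-congˡ (*-congˡ (*-congˡ (*-congˡ (pow-*ℕ q 6 N)))))) ⟨
    pow q (6 ℕ.+ 6 ℕ.* N) ∎
    where z = pow q N

  neg1^-square : ∀ n → neg1^ n * neg1^ n ≈ 1#
  neg1^-square zero    = *-identityˡ 1#
  neg1^-square (suc n) = trans
    (solve 1 (λ s → :- :1 :* s :* (:- :1 :* s) := s :* s) refl (neg1^ n)) (neg1^-square n)

  neg1^-dbl : ∀ n → neg1^ (dbl n) ≈ 1#
  neg1^-dbl n = trans (reflexive (≡.cong neg1^ (dbl≡ n))) (trans (pow-+ _ n n) (neg1^-square n))

  evenCoeff : ℕ → ℤ → Carrier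
  evenCoeff n j = neg1^ n * (neg1^ ∣ j ∣ * apow ((+ 2) ℤ.* j))

  evenW : ℕ → ℤ → Carrier
  evenW n j = evenCoeff n j * pow q (6 ℕ.* n ℕ.* n ∸ 2 ℕ.* ∣ j ∣ ℕ.* ∣ j ∣)

  -- Solving the recursion termwise: all old terms acquire the same factor, and `evenW-ends`
  -- identifies the two new terms j = n+1 and j = -n-1 with the inhomogeneous part w_(2n+2).
  evenW-suc : ∀ n j → ∣ j ∣ ≤ n → evenW (suc n) j ≈ - cube (dbl n) * evenW n j
  evenW-suc n j ∣j∣≤n = begin
    - 1# * neg1^ n * x * pow q (6 ℕ.* suc n ℕ.* suc n ∸ s)
      ≡⟨ ≡.cong (λ e → - 1# * neg1^ n * x * pow q e) (even-suc n (2kk≤6nn ∣j∣≤n)) ⟩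
    - 1# * neg1^ n * x * pow q (6 ℕ.+ 6 ℕ.* dbl n ℕ.+ (6 ℕ.* n ℕ.* n ∸ s))
      ≈⟨ *-congˡ (trans (pow-+ q (6 ℕ.+ 6 ℕ.* dbl n) _) (*-congʳ (sym (cube≈ (dbl n))))) ⟩
    - 1# * neg1^ n * x * (cube (dbl n) * pow q (6 ℕ.* n ℕ.* n ∸ s))
      ≈⟨ solve 4 (λ t x d e → :- :1 :* t :* x :* (d :* e) := :- d :* (t :* x :* e)) refl _ _ _ _ ⟩
    - cube (dbl n) * evenW n j ∎
    where
    s = 2 ℕ.* ∣ j ∣ ℕ.* ∣ j ∣
    x = neg1^ ∣ j ∣ * apow ((+ 2) ℤ.* j)

  evenW-ends : ∀ n → evenW (suc n) (+ suc n) + evenW (suc n) -[1+ n ] ≈ w (dbl (suc n))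
  evenW-ends n = begin
    s * (s * pow a (2 ℕ.* suc n)) * e + s * (s * pow a⁻ (2 ℕ.* suc n)) * e
      ≈⟨ solve 4 (λ s x y e → s :* (s :* x) :* e :+ s :* (s :* y) :* e := s :* s :* e :* (x :+ y)) refl _ _ _ _ ⟩
    s * s * e * (pow a (2 ℕ.* suc n) + pow a⁻ (2 ℕ.* suc n))
      ≈⟨ *-cong (*-cong (trans (neg1^-square (suc n)) (sym (neg1^-dbl (suc n))))
                        (reflexive (≡.cong (pow q) (even-end (suc n)))))
                (reflexive (≡.cong (λ k → pow a k + pow a⁻ k) (≡.sym (dbl≡2* (suc n))))) ⟩
    w (dbl (suc n)) ∎
    where
    s = neg1^ (suc n)
    e = pow q (6 ℕ.* suc n ℕ.* suc n ∸ 2 ℕ.* suc n ℕ.* suc n)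

  W-even : ∀ n → W (dbl n) ≈ sumTo (2 ℕ.* n) (λ i → evenW n (+ i ℤ.- + n))
  W-even zero    = solve 0 (:1 := :1 :* (:1 :* :1) :* :1) refl
  W-even (suc n) = begin
    w (dbl (suc n)) - cube (dbl n) * W (dbl n)
      ≈⟨ +-congˡ (-‿cong (*-congˡ (W-even n))) ⟩
    w (dbl (suc n)) - cube (dbl n) * sumTo (2 ℕ.* n) (λ i → evenW n (+ i ℤ.- + n))
      ≈⟨ solve 3 (λ w d s → w :- d :* s := :- d :* s :+ w) refl _ _ _ ⟩
    - cube (dbl n) * sumTo (2 ℕ.* n) (λ i → evenW n (+ i ℤ.- + n)) + w (dbl (suc n))
      ≈⟨ +-cong (trans (sumTo-*ˡ (2 ℕ.* n) _ _) (sumTo-cong-≤ (2 ℕ.* n) (λ i i≤2n →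
           sym (evenW-suc n (+ i ℤ.- + n) (∣i-n∣≤n n i i≤2n))))) (sym (evenW-ends n)) ⟩
    sumTo (2 ℕ.* n) (λ i → evenW (suc n) (+ i ℤ.- + n))
      + (evenW (suc n) (+ suc n) + evenW (suc n) -[1+ n ])
      ≈⟨ sumTo-symmetric-suc n (evenW (suc n)) ⟨
    sumTo (2 ℕ.* suc n) (λ i → evenW (suc n) (+ i ℤ.- + suc n)) ∎

  -- The weight Q^N (1 + Q^(N+1)) turns one monomial of W_N into the two monomials of the stated
  -- series. Since s ≤ e, adding to the exponent commutes with subtracting s.
  split-factor : ∀ N x {e s t u} → s ≤ e → e ℕ.+ 2 ℕ.* N ≡ t → e ℕ.+ 2 ℕ.* N ℕ.+ (2 ℕ.+ 2 ℕ.* N) ≡ u →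
    pow Q N * (1# + Q * pow Q N) * (x * pow q (e ∸ s)) ≈ x * pow q (t ∸ s) + x * pow q (u ∸ s)
  split-factor N x {e} {s} s≤e ≡.refl ≡.refl = begin
    pow Q N * (1# + Q * pow Q N) * (x * p)
      ≈⟨ *-congʳ (*-cong (pow-Q N) (+-congˡ (*-congˡ (pow-Q N)))) ⟩
    y * (1# + q * q * y) * (x * p)
      ≈⟨ solve 4 (λ q x y p → y :* (:1 :+ q :* q :* y) :* (x :* p)
               := x :* (p :* y) :+ x :* (p :* y :* (q :* (q :* y)))) refl q x y p ⟩
    x * (p * y) + x * (p * y * pow q (2 ℕ.+ 2 ℕ.* N))
      ≈⟨ +-cong (*-congˡ p*y) (*-congˡ (trans (*-congʳ p*y) (trans
           (sym (pow-+ q (e ℕ.+ 2 ℕ.* N ∸ s) (2 ℕ.+ 2 ℕ.* N)))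
           (reflexive (≡.cong (pow q) (≡.sym (ℕₚ.+-∸-comm (2 ℕ.+ 2 ℕ.* N)
             (ℕₚ.≤-trans s≤e (ℕₚ.m≤m+n e _))))))))) ⟩
    x * pow q (e ℕ.+ 2 ℕ.* N ∸ s) + x * pow q (e ℕ.+ 2 ℕ.* N ℕ.+ (2 ℕ.+ 2 ℕ.* N) ∸ s) ∎
    where
    p = pow q (e ∸ s)
    y = pow q (2 ℕ.* N)
    p*y : p * y ≈ pow q (e ℕ.+ 2 ℕ.* N ∸ s)
    p*y = trans (sym (pow-+ q (e ∸ s) (2 ℕ.* N)))
      (reflexive (≡.cong (pow q) (≡.sym (ℕₚ.+-∸-comm (2 ℕ.* N) s≤e))))

  term-even : ∀ n → term (dbl n) ≈ sumTo (2 ℕ.* n) (λ i →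
    let j = + i ℤ.- + n
        k = ∣ j ∣
    in evenCoeff n j * pow q (6 ℕ.* n ℕ.* n ℕ.+ 4 ℕ.* n ∸ 2 ℕ.* k ℕ.* k)
       + evenCoeff n j * pow q (6 ℕ.* n ℕ.* n ℕ.+ 4 ℕ.* n ℕ.+ (4 ℕ.* n ℕ.+ 2) ∸ 2 ℕ.* k ℕ.* k))
  term-even n = trans (*-congˡ (W-even n)) (trans (sumTo-*ˡ (2 ℕ.* n) _ _)
    (sumTo-cong-≤ (2 ℕ.* n) (λ i i≤2n → split-factor (dbl n) (evenCoeff n (+ i ℤ.- + n))
      (2kk≤6nn (∣i-n∣≤n n i i≤2n)) (even-low n) (even-high n))))

  oddCoeff : ℕ → ℕ → Carrier
  oddCoeff n j = neg1^ (n ℕ.+ 1) * (neg1^ j * (pow a (2 ℕ.* j ℕ.+ 1) + pow a⁻ (2 ℕ.* j ℕ.+ 1)))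

  -- The indices J = 2j+1 and J = -(2j+1) taken together: both carry the sign (-1)^(n+1+j) and the
  -- exponent (3(2n+1)² - (2j+1)²)/2.
  oddW : ℕ → ℕ → Carrier
  oddW n j = oddCoeff n j * pow q (oddExp n ∸ 2 ℕ.* j ℕ.* (j ℕ.+ 1))

  oddW-suc : ∀ n j → j ≤ n → oddW (suc n) j ≈ - cube (suc (dbl n)) * oddW n j
  oddW-suc n j j≤n = begin
    - 1# * neg1^ (n ℕ.+ 1) * x * pow q (oddExp (suc n) ∸ s)
      ≡⟨ ≡.cong (λ e → - 1# * neg1^ (n ℕ.+ 1) * x * pow q e) (odd-suc n (2jj+2j≤oddExp j≤n)) ⟩
    - 1# * neg1^ (n ℕ.+ 1) * x * pow q (6 ℕ.+ 6 ℕ.* suc (dbl n) ℕ.+ (oddExp n ∸ s))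
      ≈⟨ *-congˡ (trans (pow-+ q (6 ℕ.+ 6 ℕ.* suc (dbl n)) _) (*-congʳ (sym (cube≈ (suc (dbl n)))))) ⟩
    - 1# * neg1^ (n ℕ.+ 1) * x * (cube (suc (dbl n)) * pow q (oddExp n ∸ s))
      ≈⟨ solve 4 (λ t x d e → :- :1 :* t :* x :* (d :* e) := :- d :* (t :* x :* e)) refl _ _ _ _ ⟩
    - cube (suc (dbl n)) * oddW n j ∎
    where
    s = 2 ℕ.* j ℕ.* (j ℕ.+ 1)
    x = neg1^ j * (pow a (2 ℕ.* j ℕ.+ 1) + pow a⁻ (2 ℕ.* j ℕ.+ 1))

  oddW-end : ∀ n → oddW n n ≈ w (suc (dbl n))
  oddW-end n = begin
    neg1^ (n ℕ.+ 1) * (neg1^ n * (pow a (2 ℕ.* n ℕ.+ 1) + pow a⁻ (2 ℕ.* n ℕ.+ 1))) * pow q e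
      ≈⟨ *-cong (*-cong (reflexive (≡.cong neg1^ (ℕₚ.+-comm n 1))) (*-congˡ
           (reflexive (≡.cong (λ k → pow a k + pow a⁻ k) index))))
           (reflexive (≡.cong (pow q) (odd-end n))) ⟩
    - 1# * s * (s * X) * pow q (suc (dbl n) ℕ.* suc (dbl n))
      ≈⟨ solve 3 (λ s x e → :- :1 :* s :* (s :* x) :* e := :- :1 :* (s :* s) :* e :* x) refl _ _ _ ⟩
    - 1# * (s * s) * pow q (suc (dbl n) ℕ.* suc (dbl n)) * X
      ≈⟨ *-congʳ (*-congʳ (*-congˡ (trans (neg1^-square n) (sym (neg1^-dbl n))))) ⟩
    w (suc (dbl n)) ∎
    where
    s = neg1^ n
    X = pow a (suc (dbl n)) + pow a⁻ (suc (dbl n))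
    e = oddExp n ∸ 2 ℕ.* n ℕ.* (n ℕ.+ 1)
    index : 2 ℕ.* n ℕ.+ 1 ≡ suc (dbl n)
    index = ≡.trans (ℕₚ.+-comm (2 ℕ.* n) 1) (≡.cong suc (≡.sym (dbl≡2* n)))

  W-odd : ∀ n → W (suc (dbl n)) ≈ sumTo n (oddW n)
  W-odd zero    = sym (oddW-end 0)
  W-odd (suc n) = begin
    w (suc (dbl (suc n))) - cube (suc (dbl n)) * W (suc (dbl n))
      ≈⟨ +-congˡ (-‿cong (*-congˡ (W-odd n))) ⟩
    w (suc (dbl (suc n))) - cube (suc (dbl n)) * sumTo n (oddW n)
      ≈⟨ solve 3 (λ w d s → w :- d :* s := :- d :* s :+ w) refl _ _ _ ⟩
    - cube (suc (dbl n)) * sumTo n (oddW n) + w (suc (dbl (suc n)))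
      ≈⟨ +-cong (trans (sumTo-*ˡ n _ _) (sumTo-cong-≤ n (λ j j≤n → sym (oddW-suc n j j≤n))))
                (sym (oddW-end (suc n))) ⟩
    sumTo (suc n) (oddW (suc n)) ∎

  term-odd : ∀ n → term (suc (dbl n)) ≈ sumTo n (λ j →
    oddCoeff n j * pow q (6 ℕ.* n ℕ.* n ℕ.+ 10 ℕ.* n ℕ.+ 3 ∸ 2 ℕ.* j ℕ.* (j ℕ.+ 1))
    + oddCoeff n j * pow q (6 ℕ.* n ℕ.* n ℕ.+ 10 ℕ.* n ℕ.+ 3 ℕ.+ (4 ℕ.* n ℕ.+ 4) ∸ 2 ℕ.* j ℕ.* (j ℕ.+ 1)))
  term-odd n = trans (*-congˡ (W-odd n)) (trans (sumTo-*ˡ n _ _)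
    (sumTo-cong-≤ n (λ j j≤n → split-factor (suc (dbl n)) (oddCoeff n j)
      (2jj+2j≤oddExp j≤n) (odd-low n) (odd-high n))))

-- Convolution of power series and the truncated ring.

module PowerSeries {c ℓ} (R : CommutativeRing c ℓ) (a a⁻ : CommutativeRing.Carrier R) where
  open CommutativeRing R hiding (zero)
  open QSeries R a a⁻
  open Sums R a a⁻
  open IntegerCoefficients R
  open import Relation.Binary.Reasoning.Setoid setoid

  tail : PS → PS
  tail f i = f (suc i)

  0ₛ : PS
  0ₛ _ = 0#

  negₛ : PS → PS
  negₛ f i = - f i

  infix 4 _≈[_]_
  _≈[_]_ : PS → ℕ → PS → Set ℓ
  f ≈[ n ] g = ∀ i → i ≤ n → f i ≈ g i

  ⊗-cong : ∀ {n f f′ g g′} → f ≈[ n ] f′ → g ≈[ n ] g′ → f ⊗ g ≈[ n ] f′ ⊗ g′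
  ⊗-cong f≈f′ g≈g′ m m≤n = sumTo-cong-≤ m (λ i i≤m →
    *-cong (f≈f′ i (ℕₚ.≤-trans i≤m m≤n)) (g≈g′ (m ∸ i) (ℕₚ.≤-trans (ℕₚ.m∸n≤m m i) m≤n)))

  ⊗-congʳ : ∀ n g {f f′} → (∀ i → f i ≈ f′ i) → (f ⊗ g) n ≈ (f′ ⊗ g) n
  ⊗-congʳ n g f≈f′ = sumTo-cong n (λ i → *-congʳ (f≈f′ i))

  ⊗-suc : ∀ n f g → (f ⊗ g) (suc n) ≈ f 0 * g (suc n) + (tail f ⊗ g) n
  ⊗-suc n f g = sumTo-shift n (λ i → f i * g (suc n ∸ i))

  ⊗-suc′ : ∀ n f g → (f ⊗ g) (suc n) ≈ (f ⊗ tail g) n + f (suc n) * g 0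
  ⊗-suc′ n f g = +-cong
    (sumTo-cong-≤ n (λ i i≤n → *-congˡ (reflexive (≡.cong g (ℕₚ.+-∸-assoc 1 i≤n)))))
    (*-congˡ (reflexive (≡.cong g (ℕₚ.n∸n≡0 n))))

  -- The first summand of one convolution is the last of the other. Splitting these off makes an
  -- induction and avoids reversing the summation index.
  ⊗-comm : ∀ n f g → (f ⊗ g) n ≈ (g ⊗ f) n
  ⊗-comm zero    f g = *-comm _ _
  ⊗-comm (suc n) f g = begin
    (f ⊗ g) (suc n)                      ≈⟨ ⊗-suc n f g ⟩
    f 0 * g (suc n) + (tail f ⊗ g) n     ≈⟨ +-cong (*-comm _ _) (⊗-comm n (tail f) g) ⟩
    g (suc n) * f 0 + (g ⊗ tail f) n     ≈⟨ +-comm _ _ ⟩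
    (g ⊗ tail f) n + g (suc n) * f 0     ≈⟨ ⊗-suc′ n g f ⟨
    (g ⊗ f) (suc n)                      ∎

  ⊗-distribʳ : ∀ n h f g → ((f ⊕ g) ⊗ h) n ≈ (f ⊗ h) n + (g ⊗ h) n
  ⊗-distribʳ n h f g = trans (sumTo-cong n (λ i → distribʳ _ _ _)) (sumTo-+ n _ _)

  ⊗-scale : ∀ n x f g → ((λ i → x * f i) ⊗ g) n ≈ x * (f ⊗ g) n
  ⊗-scale n x f g = trans (sumTo-cong n (λ i → *-assoc _ _ _)) (sym (sumTo-*ˡ n x _))

  -- Induction along f = f(0) + q `tail f`, which gives tail (f g) = f(0) tail g + (tail f) g.
  ⊗-assoc : ∀ n f g h → ((f ⊗ g) ⊗ h) n ≈ (f ⊗ (g ⊗ h)) n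
  ⊗-assoc zero    f g h = *-assoc _ _ _
  ⊗-assoc (suc n) f g h = begin
    ((f ⊗ g) ⊗ h) (suc n)
      ≈⟨ ⊗-suc n (f ⊗ g) h ⟩
    f 0 * g 0 * h (suc n) + (tail (f ⊗ g) ⊗ h) n
      ≈⟨ +-congˡ (trans (⊗-congʳ n h (λ i → ⊗-suc i f g)) (⊗-distribʳ n h _ _)) ⟩
    f 0 * g 0 * h (suc n) + (((λ i → f 0 * g (suc i)) ⊗ h) n + ((tail f ⊗ g) ⊗ h) n)
      ≈⟨ +-congˡ (+-cong (⊗-scale n (f 0) (tail g) h) (⊗-assoc n (tail f) g h)) ⟩
    f 0 * g 0 * h (suc n) + (f 0 * (tail g ⊗ h) n + (tail f ⊗ (g ⊗ h)) n)
      ≈⟨ solve 5 (λ x y z u v → x :* y :* z :+ (x :* u :+ v) := x :* (y :* z :+ u) :+ v) refl _ _ _ _ _ ⟩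
    f 0 * (g 0 * h (suc n) + (tail g ⊗ h) n) + (tail f ⊗ (g ⊗ h)) n
      ≈⟨ +-congʳ (*-congˡ (⊗-suc n g h)) ⟨
    f 0 * (g ⊗ h) (suc n) + (tail f ⊗ (g ⊗ h)) n
      ≈⟨ ⊗-suc n f (g ⊗ h) ⟨
    (f ⊗ (g ⊗ h)) (suc n) ∎

  ⊗-zeroˡ : ∀ n g → (0ₛ ⊗ g) n ≈ 0#
  ⊗-zeroˡ n g = sumTo-zero n (λ i _ → zeroˡ _)

  mono-at : ∀ x k → mono x k k ≡ x
  mono-at x k with k ≟ k
  ... | yes _   = ≡.refl
  ... | no  k≢k = contradiction ≡.refl k≢k

  mono-off : ∀ x {k i} → i ≢ k → mono x k i ≡ 0#
  mono-off x {k} {i} i≢k with i ≟ k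
  ... | yes i≡k = contradiction i≡k i≢k
  ... | no  _   = ≡.refl

  mono-suc : ∀ x k i → mono x (suc k) (suc i) ≡ mono x k i
  mono-suc x k i with i ≟ k
  ... | yes ≡.refl = mono-at x (suc k)
  ... | no  i≢k    = mono-off x (i≢k ∘ ℕₚ.suc-injective)

  mono-cong : ∀ {x y} k i → x ≈ y → mono x k i ≈ mono y k i
  mono-cong k i x≈y with i ≟ k
  ... | yes _ = x≈y
  ... | no  _ = refl

  κ : Carrier → PS
  κ x = mono x 0

  κ-⊗ : ∀ n x f → (κ x ⊗ f) n ≈ x * f n
  κ-⊗ zero    x f = refl
  κ-⊗ (suc n) x f = begin
    (κ x ⊗ f) (suc n)                   ≈⟨ ⊗-suc n (κ x) f ⟩
    x * f (suc n) + (tail (κ x) ⊗ f) n  ≈⟨ +-congˡ (⊗-zeroˡ n f) ⟩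
    x * f (suc n) + 0#                  ≈⟨ +-identityʳ _ ⟩
    x * f (suc n)                       ∎

  1ₛ≈κ1 : ∀ i → 1ₛ i ≈ κ 1# i
  1ₛ≈κ1 zero    = refl
  1ₛ≈κ1 (suc i) = refl

  ⊗-identityˡ : ∀ n f → (1ₛ ⊗ f) n ≈ f n
  ⊗-identityˡ n f = trans (⊗-congʳ n f 1ₛ≈κ1) (trans (κ-⊗ n 1# f) (*-identityˡ _))

  qₛ : PS
  qₛ = mono 1# 1

  qₛ-⊗-mono : ∀ i x k → (qₛ ⊗ mono x k) i ≈ mono x (suc k) i
  qₛ-⊗-mono zero    x k = zeroˡ _
  qₛ-⊗-mono (suc i) x k = begin
    (qₛ ⊗ mono x k) (suc i)
      ≈⟨ ⊗-suc i qₛ (mono x k) ⟩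
    0# * mono x k (suc i) + (tail qₛ ⊗ mono x k) i
      ≈⟨ +-cong (zeroˡ _) (⊗-congʳ i (mono x k) (λ j → reflexive (mono-suc 1# 0 j))) ⟩
    0# + (κ 1# ⊗ mono x k) i
      ≈⟨ trans (+-identityˡ _) (trans (κ-⊗ i 1# (mono x k)) (*-identityˡ _)) ⟩
    mono x k i
      ≡⟨ mono-suc x k i ⟨
    mono x (suc k) (suc i) ∎

  -- R[[q]]/(q^(n+1)), with representatives in R[[q]].
  truncated : ℕ → CommutativeRing c ℓ
  truncated n = record
    { Carrier = PS
    ; _≈_ = _≈[ n ]_
    ; _+_ = _⊕_
    ; _*_ = _⊗_
    ; -_  = negₛ
    ; 0#  = 0ₛ
    ; 1#  = 1ₛ
    ; isCommutativeRing = record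
      { isRing = record
        { +-isAbelianGroup = record
          { isGroup = record
            { isMonoid = record
              { isSemigroup = record
                { isMagma = record
                  { isEquivalence = record
                    { refl  = λ _ _ → refl
                    ; sym   = λ f≈g i i≤n → sym (f≈g i i≤n)
                    ; trans = λ f≈g g≈h i i≤n → trans (f≈g i i≤n) (g≈h i i≤n)
                    }
                  ; ∙-cong = λ f≈f′ g≈g′ i i≤n → +-cong (f≈f′ i i≤n) (g≈g′ i i≤n)
                  }
                ; assoc = λ f g h i _ → +-assoc _ _ _
                }
              ; identity = (λ f i _ → +-identityˡ _) , (λ f i _ → +-identityʳ _)
              }
            ; inverse = (λ f i _ → -‿inverseˡ _) , (λ f i _ → -‿inverseʳ _)
            ; ⁻¹-cong = λ f≈g i i≤n → -‿cong (f≈g i i≤n)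
            }
          ; comm = λ f g i _ → +-comm _ _
          }
        ; *-cong     = ⊗-cong
        ; *-assoc    = λ f g h i _ → ⊗-assoc i f g h
        ; *-identity = (λ f i _ → ⊗-identityˡ i f) ,
                       (λ f i _ → trans (⊗-comm i f 1ₛ) (⊗-identityˡ i f))
        ; distrib    = (λ f g h i _ → trans (⊗-comm i f (g ⊕ h)) (trans (⊗-distribʳ i f g h)
                         (+-cong (⊗-comm i g f) (⊗-comm i h f)))) ,
                       (λ f g h i _ → ⊗-distribʳ i f g h)
        }
      ; *-comm = λ f g i _ → ⊗-comm i f g
      }
    }

-- Monomials, infinite sums and infinite products as finite expressions in the truncated ring.

module Truncation {c ℓ} (R : CommutativeRing c ℓ) (a a⁻ : CommutativeRing.Carrier R) (n : ℕ) where
  open PowerSeries R a a⁻ using (truncated; κ; qₛ; mono-off; mono-cong; κ-⊗; qₛ-⊗-mono; 1ₛ≈κ1)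
  open QSeries R a a⁻
    using (PS; mono; Σ∞; sumPS; prodLt; invOnePlus)
    renaming (sumTo to sumToᴿ; pow to powᴿ; neg1^ to neg1^ᴿ; apow to apowᴿ)
  private
    module R = CommutativeRing R
    module Rₚ = Sums R a a⁻
  A : CommutativeRing c ℓ
  A = truncated n
  open CommutativeRing A hiding (zero)
  open QSeries A (κ a) (κ a⁻) using (pow; neg1^; apow; sumTo)
  open Sums A (κ a) (κ a⁻)
  open IntegerCoefficients A
  open import Relation.Binary.Reasoning.Setoid setoid
  import Algebra.Properties.Ring R.ring as Rᵣ

  κ-cong : ∀ {x y} → x R.≈ y → κ x ≈ κ y
  κ-cong x≈y i _ = mono-cong 0 i x≈y

  κ-* : ∀ x y → κ (x R.* y) ≈ κ x * κ y
  κ-* x y zero    _ = R.refl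
  κ-* x y (suc i) _ = R.sym (R.trans (κ-⊗ (suc i) x (κ y)) (R.zeroʳ x))

  κ-+ : ∀ x y → κ (x R.+ y) ≈ κ x + κ y
  κ-+ x y zero    _ = R.refl
  κ-+ x y (suc i) _ = R.sym (R.+-identityˡ _)

  κ-neg : ∀ x → κ (R.- x) ≈ - κ x
  κ-neg x zero    _ = R.refl
  κ-neg x (suc i) _ = R.sym Rᵣ.-0#≈0#

  κ-1 : κ R.1# ≈ 1#
  κ-1 i _ = R.sym (1ₛ≈κ1 i)

  κ-pow : ∀ {x X} → κ x ≈ X → ∀ k → κ (powᴿ x k) ≈ pow X k
  κ-pow κx≈X zero    = κ-1
  κ-pow κx≈X (suc k) = trans (κ-* _ _) (*-cong κx≈X (κ-pow κx≈X k))

  κ-neg1^ : ∀ k → κ (neg1^ᴿ k) ≈ neg1^ k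
  κ-neg1^ = κ-pow (trans (κ-neg R.1#) (-‿cong κ-1))

  κ-apow : ∀ j → κ (apowᴿ j) ≈ apow j
  κ-apow (+ k)    = κ-pow refl k
  κ-apow -[1+ k ] = κ-pow refl (suc k)

  -- This carries the coefficientwise definitions into ring expressions in `κ x` and `qₛ`, to which
  -- the identities over a general ring apply.
  mono≈ : ∀ x k → mono x k ≈ κ x * pow qₛ k
  mono≈ x zero    = sym (*-identityʳ (κ x))
  mono≈ x (suc k) = begin
    mono x (suc k)             ≈⟨ (λ i _ → qₛ-⊗-mono i x k) ⟨
    qₛ * mono x k              ≈⟨ *-congˡ {qₛ} (mono≈ x k) ⟩
    qₛ * (κ x * pow qₛ k)      ≈⟨ solve 3 (λ q x y → q :* (x :* y) := x :* (q :* y)) refl qₛ (κ x) (pow qₛ k) ⟩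
    κ x * pow qₛ (suc k)       ∎

  mono-vanish : ∀ x {k} → n < k → mono x k ≈ 0#
  mono-vanish x n<k i i≤n = R.reflexive (mono-off x (ℕₚ.<⇒≢ (ℕₚ.≤-<-trans i≤n n<k)))

  pow-qₛ≈mono : ∀ k → pow qₛ k ≈ mono R.1# k
  pow-qₛ≈mono k = trans (sym (*-identityˡ _)) (trans (*-congʳ {pow qₛ k} (sym κ-1)) (sym (mono≈ R.1# k)))

  mono-* : ∀ x y k l → mono x k * mono y l ≈ mono (x R.* y) (k ℕ.+ l)
  mono-* x y k l = begin
    mono x k * mono y l
      ≈⟨ *-cong (mono≈ x k) (mono≈ y l) ⟩
    κ x * pow qₛ k * (κ y * pow qₛ l)
      ≈⟨ solve 4 (λ x y s t → x :* s :* (y :* t) := x :* y :* (s :* t)) refl (κ x) (κ y) (pow qₛ k) (pow qₛ l) ⟩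
    κ x * κ y * (pow qₛ k * pow qₛ l)
      ≈⟨ *-cong (κ-* x y) (pow-+ qₛ k l) ⟨
    κ (x R.* y) * pow qₛ (k ℕ.+ l)
      ≈⟨ mono≈ (x R.* y) (k ℕ.+ l) ⟨
    mono (x R.* y) (k ℕ.+ l) ∎

  sumTo-coeff : ∀ N (t : ℕ → PS) i → sumTo N t i ≡ sumToᴿ N (λ m → t m i)
  sumTo-coeff zero    t i = ≡.refl
  sumTo-coeff (suc N) t i = ≡.cong (R._+ t (suc N) i) (sumTo-coeff N t i)

  sumPS≈ : ∀ N t → sumPS N t ≈ sumTo N t
  sumPS≈ N t i _ = R.reflexive (≡.sym (sumTo-coeff N t i))

  -- The cut-off in `Σ∞` moves with the coefficient. The order condition permits one cut-off for all
  -- coefficients up to n.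
  Σ∞≈ : ∀ t → (∀ m i → i < m → t m i R.≈ R.0#) → ∀ {N} → n ≤ N → Σ∞ t ≈ sumTo N t
  Σ∞≈ t order {N} n≤N i i≤n = R.sym (R.trans (R.reflexive (≡.trans (sumTo-coeff N t i)
      (≡.cong (λ k → sumToᴿ k (λ m → t m i)) (≡.sym (ℕₚ.m+[n∸m]≡n (ℕₚ.≤-trans i≤n n≤N))))))
    (Rₚ.sumTo-extend i (N ∸ i) (λ m i<m → order m i i<m)))

  -- A telescoping geometric sum. As k ≥ 1, the remaining term has order at least n+1 and is zero in
  -- the truncated ring.
  invOnePlus-inverse : ∀ k → 1 ≤ k → (1# + mono R.1# k) * invOnePlus k ≈ 1#
  invOnePlus-inverse k 1≤k = begin
    (1# + y) * invOnePlus k       ≈⟨ *-congˡ {1# + y} (Σ∞≈ t order ℕₚ.≤-refl) ⟩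
    (1# + y) * sumTo n t          ≈⟨ geometric n ⟩
    1# - t (suc n)                ≈⟨ +-congˡ {1#} (-‿cong (mono-vanish (neg1^ᴿ (suc n)) (m≤k*m (suc n)))) ⟩
    1# - 0#                       ≈⟨ solve 0 (:1 :- :0 := :1) refl ⟩
    1#                            ∎
    where
    y = mono R.1# k
    t : ℕ → PS
    t i = mono (neg1^ᴿ i) (k ℕ.* i)
    m≤k*m : ∀ m → m ≤ k ℕ.* m
    m≤k*m m = ℕₚ.≤-trans (ℕₚ.≤-reflexive (≡.sym (ℕₚ.*-identityˡ m))) (ℕₚ.*-monoˡ-≤ m 1≤k)
    order : ∀ m i → i < m → t m i R.≈ R.0#
    order m i i<m = R.reflexive (mono-off (neg1^ᴿ m) (ℕₚ.<⇒≢ (ℕₚ.<-≤-trans i<m (m≤k*m m))))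
    t-suc : ∀ i → t (suc i) ≈ - (y * t i)
    t-suc i = begin
      mono (R.- R.1# R.* neg1^ᴿ i) (k ℕ.* suc i)
        ≡⟨ ≡.cong (mono _) (ℕₚ.*-suc k i) ⟩
      mono (R.- R.1# R.* neg1^ᴿ i) (k ℕ.+ k ℕ.* i)
        ≈⟨ mono-* (R.- R.1#) (neg1^ᴿ i) k (k ℕ.* i) ⟨
      mono (R.- R.1#) k * t i
        ≈⟨ *-congʳ {t i} (trans (mono≈ (R.- R.1#) k) (trans (*-congʳ {pow qₛ k} (κ-neg R.1#))
             (trans (solve 2 (λ x y → (:- x) :* y := :- (x :* y)) refl (κ R.1#) (pow qₛ k))
               (-‿cong (sym (mono≈ R.1# k)))))) ⟩
      - y * t i
        ≈⟨ solve 2 (λ x y → (:- x) :* y := :- (x :* y)) refl y (t i) ⟩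
      - (y * t i) ∎
    t-0 : t 0 ≈ 1#
    t-0 = trans (reflexive (≡.cong (mono R.1#) (ℕₚ.*-zeroʳ k))) κ-1
    geometric : ∀ N → (1# + y) * sumTo N t ≈ 1# - t (suc N)
    geometric zero    = begin
      (1# + y) * t 0     ≈⟨ solve 2 (λ y t → (:1 :+ y) :* t := t :- (:- (y :* t))) refl y (t 0) ⟩
      t 0 - (- (y * t 0)) ≈⟨ +-cong t-0 (-‿cong (sym (t-suc 0))) ⟩
      1# - t 1           ∎
    geometric (suc N) = begin
      (1# + y) * (sumTo N t + t (suc N))
        ≈⟨ solve 3 (λ y s t → (:1 :+ y) :* (s :+ t) := (:1 :+ y) :* s :+ t :- (:- (y :* t))) refl y (sumTo N t) (t (suc N)) ⟩
      (1# + y) * sumTo N t + t (suc N) - (- (y * t (suc N)))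
        ≈⟨ +-cong (+-congʳ {t (suc N)} (geometric N)) (-‿cong (sym (t-suc (suc N)))) ⟩
      1# - t (suc N) + t (suc N) - t (suc (suc N))
        ≈⟨ solve 2 (λ s t → :1 :- s :+ s :- t := :1 :- t) refl (t (suc N)) (t (suc (suc N))) ⟩
      1# - t (suc (suc N)) ∎

  prodLt-extend : ∀ N d (t : ℕ → PS) → (∀ j → N ≤ j → t j ≈ 1#) → prodLt (N ℕ.+ d) t ≈ prodLt N t
  prodLt-extend N zero    t t≈1 = reflexive (≡.cong (λ k → prodLt k t) (ℕₚ.+-identityʳ N))
  prodLt-extend N (suc d) t t≈1 rewrite ℕₚ.+-suc N d = begin
    prodLt (N ℕ.+ d) t * t (N ℕ.+ d)
      ≈⟨ *-cong (prodLt-extend N d t t≈1) (t≈1 (N ℕ.+ d) (ℕₚ.m≤m+n N d)) ⟩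
    prodLt N t * 1#   ≈⟨ *-identityʳ (prodLt N t) ⟩
    prodLt N t        ∎

-- Parity of the exponents.

even%2 : ∀ X Y {t s} → t ≡ 2 ℕ.* X → s ≡ 2 ℕ.* Y → (t ∸ s) % 2 ≡ 0
even%2 X Y ≡.refl ≡.refl rewrite ≡.sym (ℕₚ.*-distribˡ-∸ 2 X Y) | ℕₚ.*-comm 2 (X ∸ Y) = m*n%n≡0 (X ∸ Y) 2

-- The bound `Y ≤ X` keeps the subtraction exact: a truncated difference would be 0, hence even.
odd%2 : ∀ X Y {t s} → t ≡ suc (2 ℕ.* X) → s ≡ 2 ℕ.* Y → Y ≤ X → (t ∸ s) % 2 ≡ 1
odd%2 X Y ≡.refl ≡.refl Y≤X
  rewrite ℕₚ.+-∸-assoc 1 (ℕₚ.*-monoʳ-≤ 2 Y≤X) | ≡.sym (ℕₚ.*-distribˡ-∸ 2 X Y) | ℕₚ.*-comm 2 (X ∸ Y)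
  = [m+kn]%n≡m%n 1 (X ∸ Y) 2

module Parity where
  open +-*-Solver using (solve; con; _:*_; _:+_; _:=_)
  open import Data.Nat.Base using (_+_; _*_)

  even₁ : ∀ n k → (6 * n * n + 4 * n ∸ 2 * k * k) % 2 ≡ 0
  even₁ n k = even%2 (3 * n * n + 2 * n) (k * k)
    (solve 1 (λ n → con 6 :* n :* n :+ con 4 :* n := con 2 :* (con 3 :* n :* n :+ con 2 :* n)) ≡.refl n)
    (ℕₚ.*-assoc 2 k k)

  even₂ : ∀ n k → (6 * n * n + 4 * n + (4 * n + 2) ∸ 2 * k * k) % 2 ≡ 0
  even₂ n k = even%2 (3 * n * n + 4 * n + 1) (k * k)
    (solve 1 (λ n → con 6 :* n :* n :+ con 4 :* n :+ (con 4 :* n :+ con 2)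
      := con 2 :* (con 3 :* n :* n :+ con 4 :* n :+ con 1)) ≡.refl n)
    (ℕₚ.*-assoc 2 k k)

  -- In the odd cases X is written as n(n+1) + m so that this bound applies directly.
  j*[j+1]≤ : ∀ {n j} m → j ≤ n → j * (j + 1) ≤ n * (n + 1) + m
  j*[j+1]≤ m j≤n = ℕₚ.≤-trans (ℕₚ.*-mono-≤ j≤n (ℕₚ.+-monoˡ-≤ 1 j≤n)) (ℕₚ.m≤m+n _ m)

  odd₁ : ∀ {n j} → j ≤ n → (6 * n * n + 10 * n + 3 ∸ 2 * j * (j + 1)) % 2 ≡ 1
  odd₁ {n} {j} j≤n = odd%2 (n * (n + 1) + (2 * n * n + 4 * n + 1)) (j * (j + 1))
    (solve 1 (λ n → con 6 :* n :* n :+ con 10 :* n :+ con 3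
      := con 1 :+ con 2 :* (n :* (n :+ con 1) :+ (con 2 :* n :* n :+ con 4 :* n :+ con 1))) ≡.refl n)
    (ℕₚ.*-assoc 2 j (j + 1)) (j*[j+1]≤ (2 * n * n + 4 * n + 1) j≤n)

  odd₂ : ∀ {n j} → j ≤ n → (6 * n * n + 10 * n + 3 + (4 * n + 4) ∸ 2 * j * (j + 1)) % 2 ≡ 1
  odd₂ {n} {j} j≤n = odd%2 (n * (n + 1) + (2 * n * n + 6 * n + 3)) (j * (j + 1))
    (solve 1 (λ n → con 6 :* n :* n :+ con 10 :* n :+ con 3 :+ (con 4 :* n :+ con 4)
      := con 1 :+ con 2 :* (n :* (n :+ con 1) :+ (con 2 :* n :* n :+ con 6 :* n :+ con 3))) ≡.refl n)
    (ℕₚ.*-assoc 2 j (j + 1)) (j*[j+1]≤ (2 * n * n + 6 * n + 3) j≤n)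

-- Comparison of the coefficients of q^n.

module Assembly {c ℓ} (R : CommutativeRing c ℓ) (a a⁻ : CommutativeRing.Carrier R)
  (a*a⁻≈1 : CommutativeRing._≈_ R (CommutativeRing._*_ R a a⁻) (CommutativeRing.1# R)) (n : ℕ) where
  open PowerSeries R a a⁻ using (κ; qₛ; mono-off)
  module Tr = Truncation R a a⁻
  open Tr n hiding (A)
  open QSeries R a a⁻
    using (PS; mono; 1ₛ; _⊕_; _⊗_; Σ∞; prodLt; invOnePlus; aqPoch; qaPoch; invMinusq2Poch;
           S; P; q4Inf; RHS0; RHS1)
    renaming (pow to powᴿ; neg1^ to neg1^ᴿ; apow to apowᴿ)
  A : CommutativeRing c ℓ
  A = Tr.A n
  private
    module R = CommutativeRing R
    module Rₚ = Sums R a a⁻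
  open CommutativeRing A hiding (zero)
  open QSeries A (κ a) (κ a⁻) using (pow; neg1^; apow; sumTo)
  open Sums A (κ a) (κ a⁻)
  open IntegerCoefficients A
  open import Relation.Binary.Reasoning.Setoid setoid

  κa*κa⁻≈1 : κ a * κ a⁻ ≈ 1#
  κa*κa⁻≈1 = trans (sym (κ-* a a⁻)) (trans (κ-cong a*a⁻≈1) κ-1)

  open Identity A (κ a) (κ a⁻) qₛ κa*κa⁻≈1
  open Explicit A (κ a) (κ a⁻) qₛ κa*κa⁻≈1

  mono-1≈ : ∀ j → mono R.1# (2 ℕ.* j) ≈ pow Q j
  mono-1≈ j = trans (sym (pow-qₛ≈mono (2 ℕ.* j))) (sym (pow-Q j))

  linear≈ : ∀ x j → 1ₛ ⊕ mono (R.- x) (2 ℕ.* j ℕ.+ 1) ≈ 1# - κ x * (qₛ * pow Q j)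
  linear≈ x j = +-congˡ {1#} (begin
    mono (R.- x) (2 ℕ.* j ℕ.+ 1)             ≡⟨ ≡.cong (mono (R.- x)) (ℕₚ.+-comm (2 ℕ.* j) 1) ⟩
    mono (R.- x) (suc (2 ℕ.* j))             ≈⟨ mono≈ (R.- x) (suc (2 ℕ.* j)) ⟩
    κ (R.- x) * (qₛ * pow qₛ (2 ℕ.* j))      ≈⟨ *-cong (κ-neg x) (*-congˡ {qₛ} (sym (pow-Q j))) ⟩
    - κ x * (qₛ * pow Q j)
      ≈⟨ solve 2 (λ x y → (:- x) :* y := :- (x :* y)) refl (κ x) (qₛ * pow Q j) ⟩
    - (κ x * (qₛ * pow Q j))                 ∎)

  jacobi≈ : ∀ m → aqPoch m * qaPoch m ≈ jacobi m
  jacobi≈ zero    = *-identityˡ 1#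
  jacobi≈ (suc m) = begin
    aqPoch m * x * (qaPoch m * y)
      ≈⟨ solve 4 (λ s x t y → s :* x :* (t :* y) := s :* t :* (x :* y)) refl (aqPoch m) x (qaPoch m) y ⟩
    aqPoch m * qaPoch m * (x * y)
      ≈⟨ *-cong (jacobi≈ m) (*-cong (linear≈ a m) (linear≈ a⁻ m)) ⟩
    jacobi (suc m) ∎
    where
    x = 1ₛ ⊕ mono (R.- a) (2 ℕ.* m ℕ.+ 1)
    y = 1ₛ ⊕ mono (R.- a⁻) (2 ℕ.* m ℕ.+ 1)

  inverse : ∀ m → minusPoch m * invMinusq2Poch m ≈ 1#
  inverse zero    = *-identityˡ 1#
  inverse (suc m) = begin
    minusPoch m * (1# + Q * pow Q m) * (invMinusq2Poch m * i)
      ≈⟨ solve 4 (λ s x t y → s :* x :* (t :* y) := s :* t :* (x :* y)) refl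
           (minusPoch m) (1# + Q * pow Q m) (invMinusq2Poch m) i ⟩
    minusPoch m * invMinusq2Poch m * ((1# + Q * pow Q m) * i)
      ≈⟨ *-cong (inverse m) factor ⟩
    1# * 1#  ≈⟨ *-identityˡ 1# ⟩
    1#       ∎
    where
    i = invOnePlus (2 ℕ.* (m ℕ.+ 1))
    factor : (1# + Q * pow Q m) * i ≈ 1#
    factor = trans (*-congʳ {i} (+-congˡ {1#} (trans (sym (mono-1≈ (suc m)))
        (reflexive (≡.cong (λ k → mono R.1# (2 ℕ.* k)) (ℕₚ.+-comm 1 m))))))
      (invOnePlus-inverse (2 ℕ.* (m ℕ.+ 1)) (ℕₚ.≤-trans (ℕₚ.m≤n+m 1 m) (ℕₚ.m≤m+n (m ℕ.+ 1) _)))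

  S≈partial : ∀ {K} → n ≤ K → S ≈ partial invMinusq2Poch inverse K
  S≈partial {K} n≤K = trans (Σ∞≈ t order n≤K) (sumTo-cong K (λ m →
    *-congʳ {invMinusq2Poch m} (*-cong (jacobi≈ m) (mono-1≈ m))))
    where
    t : ℕ → PS
    t m = aqPoch m ⊗ qaPoch m ⊗ mono R.1# (2 ℕ.* m) ⊗ invMinusq2Poch m
    -- The index i is arbitrary here, so the estimate is made in the ring truncated at i instead of
    -- n, where the factor q^(2m) is zero.
    order : ∀ m i → i < m → t m i R.≈ R.0#
    order m i i<m = vanish i ℕₚ.≤-refl
      where
      module Aᵢ = CommutativeRing (Tr.A i)
      vanish : t m Aᵢ.≈ Aᵢ.0#
      vanish = Aᵢ.trans (Aᵢ.*-congʳ {invMinusq2Poch m} (Aᵢ.trans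
        (Aᵢ.*-congˡ {aqPoch m ⊗ qaPoch m} (Tr.mono-vanish i R.1# (ℕₚ.<-≤-trans i<m (ℕₚ.m≤m+n m _))))
        (Aᵢ.zeroʳ (aqPoch m ⊗ qaPoch m)))) (Aᵢ.zeroˡ (invMinusq2Poch m))

  q4Factor : ℕ → PS
  q4Factor j = 1ₛ ⊕ mono (R.- R.1#) (4 ℕ.* (j ℕ.+ 1))

  -- The length of the product defining coefficient i depends on i. Modulo q^(i+1) every later
  -- factor is 1, so all these lengths can be replaced by N.
  q4Inf≈ : ∀ {N} → n < N → q4Inf ≈ prodLt N q4Factor
  q4Inf≈ {N} n<N i i≤n = R.sym (R.trans
      (R.reflexive (≡.cong (λ k → prodLt k q4Factor i) (≡.sym (ℕₚ.m+[n∸m]≡n (ℕₚ.≤-<-trans i≤n n<N)))))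
      (Tr.prodLt-extend i (suc i) (N ∸ suc i) q4Factor factor≈1 i ℕₚ.≤-refl))
    where
    module Aᵢ = CommutativeRing (Tr.A i)
    factor≈1 : ∀ j → suc i ≤ j → q4Factor j Aᵢ.≈ Aᵢ.1#
    factor≈1 j i<j = Aᵢ.trans (Aᵢ.+-congˡ {1ₛ} (Tr.mono-vanish i (R.- R.1#)
      (ℕₚ.<-≤-trans i<j (ℕₚ.≤-trans (ℕₚ.m≤m+n j 1) (ℕₚ.m≤m+n (j ℕ.+ 1) _))))) (Aᵢ.+-identityʳ 1ₛ)

  prodLt≈squarePoch : ∀ N → prodLt N q4Factor ≈ squarePoch N
  prodLt≈squarePoch zero    = refl
  prodLt≈squarePoch (suc N) = *-cong (prodLt≈squarePoch N) (+-congˡ {1#} (begin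
    mono (R.- R.1#) (4 ℕ.* (N ℕ.+ 1))
      ≈⟨ mono≈ (R.- R.1#) (4 ℕ.* (N ℕ.+ 1)) ⟩
    κ (R.- R.1#) * pow qₛ (4 ℕ.* (N ℕ.+ 1))
      ≈⟨ *-cong (trans (κ-neg R.1#) (-‿cong κ-1)) (reflexive (≡.cong (pow qₛ) exponent)) ⟩
    - 1# * pow qₛ (2 ℕ.* suc N ℕ.+ 2 ℕ.* suc N)
      ≈⟨ *-congˡ { - 1#} (trans (pow-+ qₛ (2 ℕ.* suc N) (2 ℕ.* suc N))
           (*-cong (sym (pow-Q (suc N))) (sym (pow-Q (suc N))))) ⟩
    - 1# * (x * x)
      ≈⟨ solve 1 (λ x → (:- :1) :* (x :* x) := :- (x :* x)) refl x ⟩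
    - (x * x) ∎))
    where
    x = pow Q (suc N)
    exponent : 4 ℕ.* (N ℕ.+ 1) ≡ 2 ℕ.* suc N ℕ.+ 2 ℕ.* suc N
    exponent = ≡.trans (≡.cong (4 ℕ.*_) (ℕₚ.+-comm N 1)) (ℕₚ.*-distribʳ-+ (suc N) 2 2)

  P≈ : P ≈ sumTo n (λ k → term (dbl k)) + sumTo n (λ k → term (suc (dbl k)))
  P≈ = begin
    q4Inf * S
      ≈⟨ *-cong (trans (q4Inf≈ (s≤s n≤K)) (prodLt≈squarePoch (suc K))) (S≈partial n≤K) ⟩
    squarePoch (suc K) * partial invMinusq2Poch inverse K
      ≈⟨ squarePoch*partial invMinusq2Poch inverse K Q^≈0 ⟩
    sumTo K term
      ≈⟨ sumTo-pairs n term ⟩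
    sumTo n (λ k → term (dbl k) + term (suc (dbl k)))
      ≈⟨ sumTo-+ n (λ k → term (dbl k)) (λ k → term (suc (dbl k))) ⟩
    sumTo n (λ k → term (dbl k)) + sumTo n (λ k → term (suc (dbl k))) ∎
    where
    -- An odd bound, so that the terms up to K form n+1 pairs and both parity classes run over k ≤
    -- n, the range of `Σ∞` at coefficient n. It is also large enough for the truncation.
    K = suc (dbl n)
    n≤K : n ≤ K
    n≤K = ℕₚ.≤-trans (≡.subst (n ≤_) (≡.sym (dbl≡ n)) (ℕₚ.m≤m+n n n)) (ℕₚ.n≤1+n _)
    Q^≈0 : pow Q (suc K) ≈ 0#
    Q^≈0 = trans (sym (mono-1≈ (suc K))) (mono-vanish R.1# (ℕₚ.<-≤-trans (s≤s n≤K) (ℕₚ.m≤m+n (suc K) _)))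

  -- At coefficient n itself the cut-off of `Σ∞` is n by definition, so the right-hand sides can be
  -- compared term by term with no estimate of orders.
  Σ∞-coeff : ∀ t → Σ∞ t n R.≈ sumTo n t n
  Σ∞-coeff t = R.reflexive (≡.sym (sumTo-coeff n t n))

  RHS0≈ : RHS0 n R.≈ sumTo n (λ k → term (dbl k)) n
  RHS0≈ = R.trans (Σ∞-coeff _) (sumTo-cong n (λ k → trans (sumPS≈ (2 ℕ.* k) _)
      (trans (sumTo-cong (2 ℕ.* k) (λ i → summand k (+ i ℤ.- + k))) (sym (term-even k)))) n ℕₚ.≤-refl)
    where
    coeff≈ : ∀ k j → κ (neg1^ᴿ k R.* (neg1^ᴿ ∣ j ∣ R.* apowᴿ ((+ 2) ℤ.* j))) ≈ evenCoeff k j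
    coeff≈ k j = trans (κ-* _ _) (*-cong (κ-neg1^ k)
      (trans (κ-* _ _) (*-cong (κ-neg1^ ∣ j ∣) (κ-apow ((+ 2) ℤ.* j)))))
    summand : ∀ k j {e f} → mono (neg1^ᴿ k R.* (neg1^ᴿ ∣ j ∣ R.* apowᴿ ((+ 2) ℤ.* j))) e
        ⊕ mono (neg1^ᴿ k R.* (neg1^ᴿ ∣ j ∣ R.* apowᴿ ((+ 2) ℤ.* j))) f
      ≈ evenCoeff k j * pow qₛ e + evenCoeff k j * pow qₛ f
    summand k j {e} {f} = +-cong (trans (mono≈ _ e) (*-congʳ {pow qₛ e} (coeff≈ k j)))
                                 (trans (mono≈ _ f) (*-congʳ {pow qₛ f} (coeff≈ k j)))

  RHS1≈ : RHS1 n R.≈ sumTo n (λ k → term (suc (dbl k))) n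
  RHS1≈ = R.trans (Σ∞-coeff _) (sumTo-cong n (λ k → trans (sumPS≈ k _)
      (trans (sumTo-cong k (λ j → summand k j)) (sym (term-odd k)))) n ℕₚ.≤-refl)
    where
    x : ℕ → ℕ → R.Carrier
    x k j = neg1^ᴿ (k ℕ.+ 1) R.* (neg1^ᴿ j R.* (powᴿ a (2 ℕ.* j ℕ.+ 1) R.+ powᴿ a⁻ (2 ℕ.* j ℕ.+ 1)))
    coeff≈ : ∀ k j → κ (x k j) ≈ oddCoeff k j
    coeff≈ k j = trans (κ-* _ _) (*-cong (κ-neg1^ (k ℕ.+ 1)) (trans (κ-* _ _) (*-cong (κ-neg1^ j)
      (trans (κ-+ _ _) (+-cong (κ-pow refl (2 ℕ.* j ℕ.+ 1)) (κ-pow refl (2 ℕ.* j ℕ.+ 1)))))))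
    summand : ∀ k j {e f} →
      mono (x k j) e ⊕ mono (x k j) f ≈ oddCoeff k j * pow qₛ e + oddCoeff k j * pow qₛ f
    summand k j {e} {f} = +-cong (trans (mono≈ _ e) (*-congʳ {pow qₛ e} (coeff≈ k j)))
                                 (trans (mono≈ _ f) (*-congʳ {pow qₛ f} (coeff≈ k j)))

  P≈RHS0+RHS1 : P n R.≈ RHS0 n R.+ RHS1 n
  P≈RHS0+RHS1 = R.trans (P≈ n ℕₚ.≤-refl) (R.sym (R.+-cong RHS0≈ RHS1≈))

  mono-parity : ∀ x {k r s} → n % 2 ≡ r → k % 2 ≡ s → r ≢ s → mono x k n R.≈ R.0#
  mono-parity x n%2≡r k%2≡s r≢s = R.reflexive (mono-off x
    (λ n≡k → r≢s (≡.trans (≡.sym n%2≡r) (≡.trans (≡.cong (_% 2) n≡k) k%2≡s))))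

  RHS0-odd : n % 2 ≡ 1 → RHS0 n R.≈ R.0#
  RHS0-odd n%2≡1 = Rₚ.sumTo-zero n (λ k _ → Rₚ.sumTo-zero (2 ℕ.* k) (λ i _ →
    R.trans (R.+-cong (mono-parity _ n%2≡1 (Parity.even₁ k ∣ + i ℤ.- + k ∣) (λ ()))
                      (mono-parity _ n%2≡1 (Parity.even₂ k ∣ + i ℤ.- + k ∣) (λ ())))
            (R.+-identityˡ R.0#)))

  RHS1-even : n % 2 ≡ 0 → RHS1 n R.≈ R.0#
  RHS1-even n%2≡0 = Rₚ.sumTo-zero n (λ k _ → Rₚ.sumTo-zero k (λ j j≤k →
    R.trans (R.+-cong (mono-parity _ n%2≡0 (Parity.odd₁ j≤k) (λ ()))
                      (mono-parity _ n%2≡0 (Parity.odd₂ j≤k) (λ ())))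
            (R.+-identityˡ R.0#)))

open import Data.Product using (_×_)

theorem1 : ∀ {c ℓ} (R : CommutativeRing c ℓ) (a a⁻ : CommutativeRing.Carrier R)
    → CommutativeRing._≈_ R (CommutativeRing._*_ R a a⁻) (CommutativeRing.1# R)
    → (n : ℕ)
    → (CommutativeRing._≈_ R (QSeries.restrict2 R a a⁻ 0 (QSeries.P R a a⁻) n) (QSeries.RHS0 R a a⁻ n))
    × (CommutativeRing._≈_ R (QSeries.restrict2 R a a⁻ 1 (QSeries.P R a a⁻) n) (QSeries.RHS1 R a a⁻ n))
theorem1 R a a⁻ a*a⁻≈1 n with n % 2 in n%2≡r | m%n<n n 2
-- Each right-hand side lives on one residue class. In `P n ≈ RHS0 n + RHS1 n` the summand of the
-- other class therefore vanishes, and it also matches the zero restriction of `P` to that class.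
... | 0           | _ =
  trans P≈RHS0+RHS1 (trans (+-congˡ (RHS1-even n%2≡r)) (+-identityʳ _)) , sym (RHS1-even n%2≡r)
  where
  open CommutativeRing R
  open Assembly R a a⁻ a*a⁻≈1 n
... | 1           | _ =
  sym (RHS0-odd n%2≡r) , trans P≈RHS0+RHS1 (trans (+-congʳ (RHS0-odd n%2≡r)) (+-identityˡ _))
  where
  open CommutativeRing R
  open Assembly R a a⁻ a*a⁻≈1 n
... | suc (suc _) | s≤s (s≤s ())
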